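{- Let $S,T$ be as in the context and let $\mathrm{Pr}_T(x)$ be any $\Sigma_1$ provability predicate of $T$. Then: 1. $\mathsf{PA}+\mathrm{Con}^{\mathrm{H}}_T \vdash \mathrm{Con}^{\mathrm{S}}_T$. 2. If $T\vdash \mathrm{Con}^{\mathrm{S}}_T$, then $\mathrm{Pr}_T(x)$ satisfies $\mathbf{Ros}$. 3. If $\mathrm{Pr}_T(x)$ satisfies $\mathbf{Ros}$ and $\mathbf{C}$, then $T\vdash \mathrm{Con}^{\mathrm{S}}_T$. 4. If $\mathrm{Pr}_T(x)$ satisfies $\mathbf{Ros}$, then $T\vdash \mathrm{Con}^{\mathrm{L}}_T$. 5. If $T\vdash \mathrm{Con}^{\mathrm{L}}_T$ and $\mathrm{Pr}_T(x)$ satisfies $\mathbf{E}$, then $\mathrm{Pr}_T(x)$ satisfies $\mathbf{Ros}$.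
   Context: $\mathcal{L}_A=\{0,\mathsf{s},+,\times,\leq\}$ is the language of first-order arithmetic, and "formula" means $\mathcal{L}_A$-formula; $\ulcorner\varphi\urcorner$ is the numeral of the Gödel number of $\varphi$. $S$ and $T$ are consistent c.e. extensions of Peano Arithmetic $\mathsf{PA}$ in the language $\mathcal{L}_A$ such that $T$ is stronger than $S$ (every theorem of $S$ is a theorem of $T$; $S=T$ is allowed). A formula $\mathrm{Pr}_T(x)$ is a provability predicate of $T$ if for every formula $\varphi$: $T\vdash\varphi$ if and only if $S\vdash\mathrm{Pr}_T(\ulcorner\varphi\urcorner)$. A $\Sigma_1$ provability predicate is one that is a $\Sigma_1$ formula. $\mathrm{Fml}_{\mathcal{L}_A}(x)$ is a natural formula expressing "$x$ is the Gödel number of an $\mathcal{L}_A$-formula", and $\dot\neg\,x$ is a term for the primitive recursive function sending the Gödel number of $\varphi$ to that of $\neg\varphi$. Consistency statements: - $\mathrm{Con}^{\mathrm{H}}_T :\equiv \forall x\,(\mathrm{Fml}_{\mathcal{L}_A}(x)\land \mathrm{Pr}_T(x)\to\neg\,\mathrm{Pr}_T(\dot\neg\,x))$. - $\mathrm{Con}^{\mathrm{S}}_T := \{\mathrm{Pr}_T(\ulcorner\varphi\urcorner)\to\neg\,\mathrm{Pr}_T(\ulcorner\neg\varphi\urcorner)\mid \varphi \text{ a formula}\}$ (a set of sentences; a theory proves it if it proves every member). - $\mathrm{Con}^{\mathrm{L}}_T :\equiv \neg\,\mathrm{Pr}_T(\ulcorner 0=1\urcorner)$. Conditions on $\mathrm{Pr}_T(x)$: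 - $\mathbf{E}$: for all formulas $\varphi,\psi$, if $T\vdash\varphi\leftrightarrow\psi$, then $S\vdash\mathrm{Pr}_T(\ulcorner\varphi\urcorner)\leftrightarrow\mathrm{Pr}_T(\ulcorner\psi\urcorner)$. - $\mathbf{C}$: $S\vdash\mathrm{Pr}_T(\ulcorner\varphi\urcorner)\land\mathrm{Pr}_T(\ulcorner\psi\urcorner)\to\mathrm{Pr}_T(\ulcorner\varphi\land\psi\urcorner)$ for all formulas $\varphi,\psi$. - $\mathbf{Ros}$: for every formula $\varphi$, if $T\vdash\neg\varphi$, then $T\vdash\neg\,\mathrm{Pr}_T(\ulcorner\varphi\urcorner)$. -}

module Defs where

open import Data.Fin.Base using (Fin; zero; suc; toℕ)
open import Data.List.Base using (List; []; _∷_; map)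
open import Data.List.Membership.Propositional using (_∈_)
open import Data.Nat.Base as ℕ using (ℕ; zero; suc)
open import Data.Product.Base using (∃; ∃₂; _×_)
open import Data.Vec.Base using (Vec; []; _∷_; lookup)
open import Function.Base using (const)
open import Function.Bundles using (_⇔_)
open import Level using (0ℓ)
open import Relation.Binary.PropositionalEquality.Core using (_≡_)
open import Relation.Nullary.Negation.Core using (¬_)
open import Relation.Unary using (Pred)

-- Terms and formulas over L_A are well-scoped de Bruijn: Formula n has free
-- variables among 0, …, n - 1, variable 0 being bound by the innermost binder.

infixl 8 _⊗_
infixl 7 _⊕_
infix  6 _≐_ _≦_
infix  5 ~_
infixr 4 _∧_
infixr 3 _∨_
infixr 2 _⇒_
infix  1 _⟺_

data Term (n : ℕ) : Set where
  var     : Fin n → Term n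
  𝟘       : Term n
  𝗌       : Term n → Term n
  _⊕_ _⊗_ : Term n → Term n → Term n

data Formula (n : ℕ) : Set where
  _≐_ _≦_     : Term n → Term n → Formula n
  ~_          : Formula n → Formula n
  _∧_ _∨_ _⇒_ : Formula n → Formula n → Formula n
  all ex      : Formula (suc n) → Formula n

Sentence : Set
Sentence = Formula 0

_⟺_ : ∀ {n} → Formula n → Formula n → Formula n
φ ⟺ ψ = (φ ⇒ ψ) ∧ (ψ ⇒ φ)

numeral : ∀ {n} → ℕ → Term n
numeral zero    = 𝟘
numeral (suc k) = 𝗌 (numeral k)

liftᵣ : ∀ {m n} → (Fin m → Fin n) → Fin (suc m) → Fin (suc n)
liftᵣ ρ zero    = zero
liftᵣ ρ (suc i) = suc (ρ i)

renᵗ : ∀ {m n} → (Fin m → Fin n) → Term m → Term n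
renᵗ ρ (var i) = var (ρ i)
renᵗ ρ 𝟘       = 𝟘
renᵗ ρ (𝗌 t)   = 𝗌 (renᵗ ρ t)
renᵗ ρ (t ⊕ u) = renᵗ ρ t ⊕ renᵗ ρ u
renᵗ ρ (t ⊗ u) = renᵗ ρ t ⊗ renᵗ ρ u

ren : ∀ {m n} → (Fin m → Fin n) → Formula m → Formula n
ren ρ (t ≐ u) = renᵗ ρ t ≐ renᵗ ρ u
ren ρ (t ≦ u) = renᵗ ρ t ≦ renᵗ ρ u
ren ρ (~ φ)   = ~ ren ρ φ
ren ρ (φ ∧ ψ) = ren ρ φ ∧ ren ρ ψ
ren ρ (φ ∨ ψ) = ren ρ φ ∨ ren ρ ψ
ren ρ (φ ⇒ ψ) = ren ρ φ ⇒ ren ρ ψ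
ren ρ (all φ) = all (ren (liftᵣ ρ) φ)
ren ρ (ex φ)  = ex (ren (liftᵣ ρ) φ)

wkᵗ : ∀ {n} → Term n → Term (suc n)
wkᵗ = renᵗ suc

wk : ∀ {n} → Formula n → Formula (suc n)
wk = ren suc

inContext : ∀ {n} → Sentence → Formula n
inContext = ren λ ()

liftₛ : ∀ {m n} → (Fin m → Term n) → Fin (suc m) → Term (suc n)
liftₛ σ zero    = var zero
liftₛ σ (suc i) = wkᵗ (σ i)

subᵗ : ∀ {m n} → (Fin m → Term n) → Term m → Term n
subᵗ σ (var i) = σ i
subᵗ σ 𝟘       = 𝟘
subᵗ σ (𝗌 t)   = 𝗌 (subᵗ σ t)
subᵗ σ (t ⊕ u) = subᵗ σ t ⊕ subᵗ σ u
subᵗ σ (t ⊗ u) = subᵗ σ t ⊗ subᵗ σ u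

sub : ∀ {m n} → (Fin m → Term n) → Formula m → Formula n
sub σ (t ≐ u) = subᵗ σ t ≐ subᵗ σ u
sub σ (t ≦ u) = subᵗ σ t ≦ subᵗ σ u
sub σ (~ φ)   = ~ sub σ φ
sub σ (φ ∧ ψ) = sub σ φ ∧ sub σ ψ
sub σ (φ ∨ ψ) = sub σ φ ∨ sub σ ψ
sub σ (φ ⇒ ψ) = sub σ φ ⇒ sub σ ψ
sub σ (all φ) = all (sub (liftₛ σ) φ)
sub σ (ex φ)  = ex (sub (liftₛ σ) φ)

inst : ∀ {n} → Term n → Fin (suc n) → Term n
inst t zero    = t
inst t (suc i) = var i

infix 9 _[_] _⟨_⟩

_[_] : ∀ {n} → Formula (suc n) → Term n → Formula n
φ [ t ] = sub (inst t) φ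

-- φ(t) for a formula φ(x) with no free variable other than x; unlike
-- _[_], the term t may live in any context.
_⟨_⟩ : ∀ {n} → Formula 1 → Term n → Formula n
φ ⟨ t ⟩ = sub (const t) φ

Theory : Set₁
Theory = Pred Sentence 0ℓ

infix 0 _∣_⊢_ _⊢_ _⊢*_

data _∣_⊢_ (T : Theory) : ∀ {n} → List (Formula n) → Formula n → Set where
  ax  : ∀ {n} {Γ : List (Formula n)} {σ} → T σ → T ∣ Γ ⊢ inContext σ
  hyp : ∀ {n} {Γ : List (Formula n)} {φ} → φ ∈ Γ → T ∣ Γ ⊢ φ
  ¬I  : ∀ {n} {Γ : List (Formula n)} {φ ψ} →
        T ∣ φ ∷ Γ ⊢ ψ → T ∣ φ ∷ Γ ⊢ ~ ψ → T ∣ Γ ⊢ ~ φ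
  ¬E  : ∀ {n} {Γ : List (Formula n)} {φ ψ} →
        T ∣ Γ ⊢ φ → T ∣ Γ ⊢ ~ φ → T ∣ Γ ⊢ ψ
  lem : ∀ {n} {Γ : List (Formula n)} {φ} → T ∣ Γ ⊢ φ ∨ ~ φ
  ∧I  : ∀ {n} {Γ : List (Formula n)} {φ ψ} →
        T ∣ Γ ⊢ φ → T ∣ Γ ⊢ ψ → T ∣ Γ ⊢ φ ∧ ψ
  ∧E₁ : ∀ {n} {Γ : List (Formula n)} {φ ψ} → T ∣ Γ ⊢ φ ∧ ψ → T ∣ Γ ⊢ φ
  ∧E₂ : ∀ {n} {Γ : List (Formula n)} {φ ψ} → T ∣ Γ ⊢ φ ∧ ψ → T ∣ Γ ⊢ ψ
  ∨I₁ : ∀ {n} {Γ : List (Formula n)} {φ ψ} → T ∣ Γ ⊢ φ → T ∣ Γ ⊢ φ ∨ ψ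
  ∨I₂ : ∀ {n} {Γ : List (Formula n)} {φ ψ} → T ∣ Γ ⊢ ψ → T ∣ Γ ⊢ φ ∨ ψ
  ∨E  : ∀ {n} {Γ : List (Formula n)} {φ ψ χ} →
        T ∣ Γ ⊢ φ ∨ ψ → T ∣ φ ∷ Γ ⊢ χ → T ∣ ψ ∷ Γ ⊢ χ → T ∣ Γ ⊢ χ
  ⇒I  : ∀ {n} {Γ : List (Formula n)} {φ ψ} → T ∣ φ ∷ Γ ⊢ ψ → T ∣ Γ ⊢ φ ⇒ ψ
  ⇒E  : ∀ {n} {Γ : List (Formula n)} {φ ψ} →
        T ∣ Γ ⊢ φ ⇒ ψ → T ∣ Γ ⊢ φ → T ∣ Γ ⊢ ψ
  ∀I  : ∀ {n} {Γ : List (Formula n)} {φ} →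
        T ∣ map wk Γ ⊢ φ → T ∣ Γ ⊢ all φ
  ∀E  : ∀ {n} {Γ : List (Formula n)} {φ} (t : Term n) →
        T ∣ Γ ⊢ all φ → T ∣ Γ ⊢ φ [ t ]
  ∃I  : ∀ {n} {Γ : List (Formula n)} {φ} (t : Term n) →
        T ∣ Γ ⊢ φ [ t ] → T ∣ Γ ⊢ ex φ
  ∃E  : ∀ {n} {Γ : List (Formula n)} {φ χ} →
        T ∣ Γ ⊢ ex φ → T ∣ φ ∷ map wk Γ ⊢ wk χ → T ∣ Γ ⊢ χ
  ≐I  : ∀ {n} {Γ : List (Formula n)} {t} → T ∣ Γ ⊢ t ≐ t
  ≐E  : ∀ {n} {Γ : List (Formula n)} (φ : Formula (suc n)) {t u} →
        T ∣ Γ ⊢ t ≐ u → T ∣ Γ ⊢ φ [ t ] → T ∣ Γ ⊢ φ [ u ]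

_⊢_ : ∀ {n} → Theory → Formula n → Set
T ⊢ φ = T ∣ [] ⊢ φ

_⊢*_ : Theory → Pred Sentence 0ℓ → Set
T ⊢* X = ∀ {σ} → X σ → T ⊢ σ

Consistent : Theory → Set
Consistent T = ¬ (∃ λ (σ : Sentence) → (T ⊢ σ) × (T ⊢ ~ σ))

infix 0 _Extends_

_Extends_ : Theory → Theory → Set
T Extends S = ∀ {n} (φ : Formula n) → S ⊢ φ → T ⊢ φ

∀* : ∀ {n} → Formula n → Sentence
∀* {zero}  φ = φ
∀* {suc n} φ = ∀* (all φ)

x₀ : ∀ {n} → Term (1 ℕ.+ n)
x₀ = var zero

x₁ : ∀ {n} → Term (2 ℕ.+ n)
x₁ = var (suc zero)

x₂ : ∀ {n} → Term (3 ℕ.+ n)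
x₂ = var (suc (suc zero))

x₃ : ∀ {n} → Term (4 ℕ.+ n)
x₃ = var (suc (suc (suc zero)))

-- φ(s x), where x is variable 0
succInst : ∀ {n} → Formula (suc n) → Formula (suc n)
succInst {n} = sub σ
  where
  σ : Fin (suc n) → Term (suc n)
  σ zero    = 𝗌 (var zero)
  σ (suc i) = var (suc i)

data PA : Theory where
  s≢0   : PA (all (~ (𝗌 x₀ ≐ 𝟘)))
  s-inj : PA (all (all (𝗌 x₁ ≐ 𝗌 x₀ ⇒ x₁ ≐ x₀)))
  +-0   : PA (all (x₀ ⊕ 𝟘 ≐ x₀))
  +-s   : PA (all (all (x₁ ⊕ 𝗌 x₀ ≐ 𝗌 (x₁ ⊕ x₀))))
  ×-0   : PA (all (x₀ ⊗ 𝟘 ≐ 𝟘))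
  ×-s   : PA (all (all (x₁ ⊗ 𝗌 x₀ ≐ x₁ ⊗ x₀ ⊕ x₁)))
  ≤-def : PA (all (all (x₁ ≦ x₀ ⟺ ex (x₀ ⊕ x₂ ≐ x₁))))
  ind   : ∀ {n} (φ : Formula (suc n)) →
          PA (∀* (φ [ 𝟘 ] ∧ all (φ ⇒ succInst φ) ⇒ all φ))

all≤ ex≤ : ∀ {n} → Term n → Formula (suc n) → Formula n
all≤ t φ = all (var zero ≦ wkᵗ t ⇒ φ)
ex≤  t φ = ex  (var zero ≦ wkᵗ t ∧ φ)

data Δ₀ {n} : Formula n → Set where
  eq    : ∀ t u → Δ₀ (t ≐ u)
  le    : ∀ t u → Δ₀ (t ≦ u)
  neg   : ∀ {φ} → Δ₀ φ → Δ₀ (~ φ)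
  and   : ∀ {φ ψ} → Δ₀ φ → Δ₀ ψ → Δ₀ (φ ∧ ψ)
  or    : ∀ {φ ψ} → Δ₀ φ → Δ₀ ψ → Δ₀ (φ ∨ ψ)
  imp   : ∀ {φ ψ} → Δ₀ φ → Δ₀ ψ → Δ₀ (φ ⇒ ψ)
  ball  : ∀ t {φ} → Δ₀ φ → Δ₀ (all≤ t φ)
  bex   : ∀ t {φ} → Δ₀ φ → Δ₀ (ex≤ t φ)

data Σ₁ {n} : Formula n → Set where
  Δ₀⇒Σ₁ : ∀ {φ} → Δ₀ φ → Σ₁ φ
  exs   : ∀ {φ} → Σ₁ φ → Σ₁ (ex φ)

-- An injective pairing that is a polynomial, hence an L_A-term: the square
-- (a + b)² determines a + b, because (a + b)² ≤ pair a b < (a + b + 1)².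
pair : ℕ → ℕ → ℕ
pair a b = (a ℕ.+ b) ℕ.* (a ℕ.+ b) ℕ.+ a

pairᵗ : ∀ {n} → Term n → Term n → Term n
pairᵗ t u = (t ⊕ u) ⊗ (t ⊕ u) ⊕ t

-- All tags are positive, so the number of an expression exceeds the numbers
-- of its immediate constituents.
tag-var tag-𝟘 tag-𝗌 tag-⊕ tag-⊗ : ℕ
tag-var = 1
tag-𝟘   = 2
tag-𝗌   = 3
tag-⊕   = 4
tag-⊗   = 5

tag-≐ tag-≦ tag-~ tag-∧ tag-∨ tag-⇒ tag-all tag-ex : ℕ
tag-≐   = 6
tag-≦   = 7
tag-~   = 8
tag-∧   = 9
tag-∨   = 10
tag-⇒   = 11
tag-all = 12
tag-ex  = 13

gnᵗ : ∀ {n} → Term n → ℕ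
gnᵗ (var i) = pair tag-var (toℕ i)
gnᵗ 𝟘       = pair tag-𝟘 0
gnᵗ (𝗌 t)   = pair tag-𝗌 (gnᵗ t)
gnᵗ (t ⊕ u) = pair tag-⊕ (pair (gnᵗ t) (gnᵗ u))
gnᵗ (t ⊗ u) = pair tag-⊗ (pair (gnᵗ t) (gnᵗ u))

-- The number does not mention the ambient context n: a formula keeps its
-- number when regarded as a formula over a larger context via inject₁.
gn : ∀ {n} → Formula n → ℕ
gn (t ≐ u) = pair tag-≐ (pair (gnᵗ t) (gnᵗ u))
gn (t ≦ u) = pair tag-≦ (pair (gnᵗ t) (gnᵗ u))
gn (~ φ)   = pair tag-~ (gn φ)
gn (φ ∧ ψ) = pair tag-∧ (pair (gn φ) (gn ψ))
gn (φ ∨ ψ) = pair tag-∨ (pair (gn φ) (gn ψ))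
gn (φ ⇒ ψ) = pair tag-⇒ (pair (gn φ) (gn ψ))
gn (all φ) = pair tag-all (gn φ)
gn (ex φ)  = pair tag-ex (gn φ)

⌜_⌝ : ∀ {n} → Formula n → Term 0
⌜ φ ⌝ = numeral (gn φ)

-- With this numbering the function gn φ ↦ gn (~ φ) is given by an L_A-term.
¬̇_ : ∀ {n} → Term n → Term n
¬̇ t = pairᵗ (numeral tag-~) t

-- A pair (m , c) codes the finite set { y ∣ 1 + (1 + y)·m divides c }.
-- If m is divisible by 1, …, k, the moduli for y < k are pairwise coprime,
-- so every set of numbers below k is the restriction of some (m , c).
Elem : ∀ {n} → (m c y : Term n) → Formula n
Elem m c y = ex≤ c (wkᵗ c ≐ x₀ ⊗ 𝗌 (𝗌 (wkᵗ y) ⊗ wkᵗ m))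

-- y = pair k z (resp. y = pair k (pair z w)) for some z (and w) in (m , c)
Unary Binary : ∀ {n} → ℕ → (m c y : Term n) → Formula n
Unary k m c y =
  ex≤ y (Elem (wkᵗ m) (wkᵗ c) x₀ ∧ wkᵗ y ≐ pairᵗ (numeral k) x₀)
Binary k m c y =
  ex≤ y (ex≤ (wkᵗ y)
    (Elem (wkᵗ (wkᵗ m)) (wkᵗ (wkᵗ c)) x₁ ∧
     Elem (wkᵗ (wkᵗ m)) (wkᵗ (wkᵗ c)) x₀ ∧
     wkᵗ (wkᵗ y) ≐ pairᵗ (numeral k) (pairᵗ x₁ x₀)))

-- y is formed by a term-forming operation from elements of (m , c)
TermStep : ∀ {n} → (m c y : Term n) → Formula n
TermStep m c y =
    ex≤ y (wkᵗ y ≐ pairᵗ (numeral tag-var) x₀)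
  ∨ y ≐ pairᵗ (numeral tag-𝟘) 𝟘
  ∨ Unary tag-𝗌 m c y
  ∨ Binary tag-⊕ m c y
  ∨ Binary tag-⊗ m c y

-- y is an atomic formula on elements of (m , c), or formed by a connective
-- or quantifier from elements of (m , d)
FmlStep : ∀ {n} → (m c d y : Term n) → Formula n
FmlStep m c d y =
    Binary tag-≐ m c y
  ∨ Binary tag-≦ m c y
  ∨ Unary tag-~ m d y
  ∨ Binary tag-∧ m d y
  ∨ Binary tag-∨ m d y
  ∨ Binary tag-⇒ m d y
  ∨ Unary tag-all m d y
  ∨ Unary tag-ex m d y

-- There are finite sets (m , c) of terms and (m , d) of formulas with x in
-- the latter, all of whose members up to x are formed from smaller members.
-- Under ∃m ∃c ∃d the variables x, m, c, d are x₃, x₂, x₁, x₀; under the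
-- further bounded ∀y they are shifted once more.
Fml : Formula 1
Fml = ex (ex (ex
  ( Elem x₂ x₀ x₃
  ∧ all≤ x₃ (Elem x₃ x₂ x₀ ⇒ TermStep x₃ x₂ x₀)
  ∧ all≤ x₃ (Elem x₃ x₁ x₀ ⇒ FmlStep x₃ x₂ x₁ x₀))))

-- Partial recursive functions; f · xs ↓ y means that f halts at xs with value y.
-- A set is c.e. if it is the domain of a unary one.

data Rec : ℕ → Set where
  zeroᴿ : ∀ {k} → Rec k
  sucᴿ  : Rec 1
  projᴿ : ∀ {k} → Fin k → Rec k
  compᴿ : ∀ {k l} → Rec l → Vec (Rec k) l → Rec k
  precᴿ : ∀ {k} → Rec k → Rec (2 ℕ.+ k) → Rec (suc k)
  μᴿ    : ∀ {k} → Rec (suc k) → Rec k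

infix 4 _·_↓_ _·*_↓_

mutual
  data _·_↓_ : ∀ {k} → Rec k → Vec ℕ k → ℕ → Set where
    zero↓  : ∀ {k} {xs : Vec ℕ k} → zeroᴿ · xs ↓ 0
    suc↓   : ∀ {x} → sucᴿ · x ∷ [] ↓ suc x
    proj↓  : ∀ {k} {xs : Vec ℕ k} i → projᴿ i · xs ↓ lookup xs i
    comp↓  : ∀ {k l} {f : Rec l} {gs : Vec (Rec k) l} {xs ys y} →
             gs ·* xs ↓ ys → f · ys ↓ y → compᴿ f gs · xs ↓ y
    prec↓₀ : ∀ {k} {f : Rec k} {g xs y} →
             f · xs ↓ y → precᴿ f g · 0 ∷ xs ↓ y
    prec↓ₛ : ∀ {k} {f : Rec k} {g xs n y z} →
             precᴿ f g · n ∷ xs ↓ y → g · n ∷ y ∷ xs ↓ z →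
             precᴿ f g · suc n ∷ xs ↓ z
    μ↓     : ∀ {k} {f : Rec (suc k)} {xs y} →
             f · y ∷ xs ↓ 0 →
             (∀ {z} → z ℕ.< y → ∃ λ w → f · z ∷ xs ↓ suc w) →
             μᴿ f · xs ↓ y

  data _·*_↓_ {k} : ∀ {l} → Vec (Rec k) l → Vec ℕ k → Vec ℕ l → Set where
    []  : ∀ {xs} → [] ·* xs ↓ []
    _∷_ : ∀ {l} {f : Rec k} {fs : Vec (Rec k) l} {xs y ys} →
          f · xs ↓ y → fs ·* xs ↓ ys → f ∷ fs ·* xs ↓ y ∷ ys

CE : Pred ℕ 0ℓ → Set
CE A = ∃ λ (f : Rec 1) → ∀ x → A x ⇔ (∃ λ y → f · x ∷ [] ↓ y)

CETheory : Theory → Set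
CETheory T = CE λ x → ∃ λ (σ : Sentence) → T σ × x ≡ gn σ

-- "For every formula φ" quantifies over the context of φ as well. Two formulas
-- always have a common context, in which their Gödel numbers are unchanged.

ProvabilityPredicate : (S T : Theory) → Formula 1 → Set
ProvabilityPredicate S T Pr =
  ∀ {n} (φ : Formula n) → (T ⊢ φ) ⇔ (S ⊢ Pr ⟨ ⌜ φ ⌝ ⟩)

Conᴴ : Formula 1 → Sentence
Conᴴ Pr = all (Fml ∧ Pr ⇒ ~ Pr ⟨ ¬̇ x₀ ⟩)

Conˢ : Formula 1 → Pred Sentence 0ℓ
Conˢ Pr σ =
  ∃₂ λ n (φ : Formula n) → σ ≡ (Pr ⟨ ⌜ φ ⌝ ⟩ ⇒ ~ Pr ⟨ ⌜ ~ φ ⌝ ⟩)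

Conᴸ : Formula 1 → Sentence
Conᴸ Pr = ~ Pr ⟨ ⌜ 𝟘 {0} ≐ 𝗌 𝟘 ⌝ ⟩

CondE : (S T : Theory) → Formula 1 → Set
CondE S T Pr = ∀ {n} (φ ψ : Formula n) →
  T ⊢ φ ⟺ ψ → S ⊢ Pr ⟨ ⌜ φ ⌝ ⟩ ⟺ Pr ⟨ ⌜ ψ ⌝ ⟩

CondC : (S : Theory) → Formula 1 → Set
CondC S Pr = ∀ {n} (φ ψ : Formula n) →
  S ⊢ Pr ⟨ ⌜ φ ⌝ ⟩ ∧ Pr ⟨ ⌜ ψ ⌝ ⟩ ⇒ Pr ⟨ ⌜ φ ∧ ψ ⌝ ⟩

Ros : (T : Theory) → Formula 1 → Set
Ros T Pr = ∀ {n} (φ : Formula n) → T ⊢ ~ φ → T ⊢ ~ Pr ⟨ ⌜ φ ⌝ ⟩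

{-# OPTIONS --safe #-}
module Submission where

-- Parts 2–5 are propositional. For part 1, instantiate Conᴴ at ⌜φ⌝: what is
-- left is that PA proves Fml(⌜φ⌝). This is a Σ₁ sentence, so by
-- Σ₁-completeness it is enough that it holds in ℕ. There, let m = K! with K
-- bounding the codes of all subterms and subformulas of φ; the numbers
-- 1 + (1 + y)·m for y ≤ K are then pairwise coprime, so the products of those
-- belonging to the subterms and to the subformulas code exactly these sets.

open import Defs
open import Data.Fin.Base using (Fin; zero; suc; toℕ)
open import Data.List.Base using (List; []; _∷_; _++_; map)
open import Data.List.Extrema.Nat using (max; xs≤max)
open import Data.List.Membership.Propositional using (_∈_)
open import Data.List.Membership.Propositional.Properties using (∈-++⁺ˡ; ∈-++⁺ʳ; ∈-map⁺)
open import Data.List.Relation.Binary.Subset.Propositional using (_⊆_)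
open import Data.List.Relation.Binary.Subset.Propositional.Properties using (map⁺; ∷⁺ʳ; xs⊆x∷xs)
open import Data.List.Relation.Unary.All as All using (All; []; _∷_)
import Data.List.Relation.Unary.All.Properties as All
open import Data.List.Relation.Unary.Any using (here; there)
open import Data.Nat.Base as ℕ using (ℕ; zero; suc; _≤_; _!; NonZero; z≤n; s≤s)
open import Data.Nat.Coprimality using (Coprime; coprime-divisor)
open import Data.Nat.Divisibility using (divides; ∣-refl; ∣-trans; ∣1⇒≡1; ∣m+n∣m⇒∣n; ∣n⇒∣m*n; m∣m*n; m≤n⇒m!∣n!) renaming (_∣_ to _∣ℕ_)
open import Data.Nat.ListAction using (product)
open import Data.Nat.ListAction.Properties using (∈⇒∣product)
open import Data.Nat.Properties as ℕ using (≤-refl; ≤-trans; ≤-reflexive)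
open import Data.Product.Base using (∃; _×_; _,_; proj₁; proj₂)
open import Data.Sum.Base as Sum using (_⊎_; inj₁; inj₂; [_,_]′)
open import Data.Vec.Functional as Vector using (Vector)
open import Function.Base using (_∘_; id; const)
open import Function.Bundles using (module Equivalence)
open import Level using (0ℓ)
open import Relation.Binary.Definitions using (tri<; tri≈; tri>)
open import Relation.Binary.PropositionalEquality using (_≡_; _≢_; _≗_; refl; sym; trans; cong; cong₂; subst)
open import Relation.Nullary.Decidable.Core using (yes; no)
open import Relation.Nullary.Negation.Core using (¬_; contradiction)
open import Relation.Unary using (Pred; _∪_; ｛_｝)
import Relation.Unary as Unary

private
  variable
    l m n : ℕ
    T : Theory
    Γ Δ : List (Formula n)
    φ ψ χ : Formula n
    t u v : Term n

-- Renaming and substitution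

renᵗ≡subᵗ : {f : Fin m → Fin n} → renᵗ f ≗ subᵗ (var ∘ f)
renᵗ≡subᵗ (var i) = refl
renᵗ≡subᵗ 𝟘       = refl
renᵗ≡subᵗ (𝗌 t)   = cong 𝗌 (renᵗ≡subᵗ t)
renᵗ≡subᵗ (t ⊕ u) = cong₂ _⊕_ (renᵗ≡subᵗ t) (renᵗ≡subᵗ u)
renᵗ≡subᵗ (t ⊗ u) = cong₂ _⊗_ (renᵗ≡subᵗ t) (renᵗ≡subᵗ u)

module _ {σ τ : Fin m → Term n} (σ≗τ : σ ≗ τ) where

  subᵗ-cong : subᵗ σ ≗ subᵗ τ
  subᵗ-cong (var i) = σ≗τ i
  subᵗ-cong 𝟘       = refl
  subᵗ-cong (𝗌 t)   = cong 𝗌 (subᵗ-cong t)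
  subᵗ-cong (t ⊕ u) = cong₂ _⊕_ (subᵗ-cong t) (subᵗ-cong u)
  subᵗ-cong (t ⊗ u) = cong₂ _⊗_ (subᵗ-cong t) (subᵗ-cong u)

  liftₛ-cong : liftₛ σ ≗ liftₛ τ
  liftₛ-cong zero    = refl
  liftₛ-cong (suc i) = cong wkᵗ (σ≗τ i)

sub-cong : {σ τ : Fin m → Term n} → σ ≗ τ → sub σ ≗ sub τ
sub-cong e (t ≐ u) = cong₂ _≐_ (subᵗ-cong e t) (subᵗ-cong e u)
sub-cong e (t ≦ u) = cong₂ _≦_ (subᵗ-cong e t) (subᵗ-cong e u)
sub-cong e (~ φ)   = cong ~_ (sub-cong e φ)
sub-cong e (φ ∧ ψ) = cong₂ _∧_ (sub-cong e φ) (sub-cong e ψ)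
sub-cong e (φ ∨ ψ) = cong₂ _∨_ (sub-cong e φ) (sub-cong e ψ)
sub-cong e (φ ⇒ ψ) = cong₂ _⇒_ (sub-cong e φ) (sub-cong e ψ)
sub-cong e (all φ) = cong all (sub-cong (liftₛ-cong e) φ)
sub-cong e (ex φ)  = cong ex (sub-cong (liftₛ-cong e) φ)

subᵗ-var : subᵗ {n} var ≗ id
subᵗ-var (var i) = refl
subᵗ-var 𝟘       = refl
subᵗ-var (𝗌 t)   = cong 𝗌 (subᵗ-var t)
subᵗ-var (t ⊕ u) = cong₂ _⊕_ (subᵗ-var t) (subᵗ-var u)
subᵗ-var (t ⊗ u) = cong₂ _⊗_ (subᵗ-var t) (subᵗ-var u)

liftₛ-var : (f : Fin m → Fin n) → liftₛ (var ∘ f) ≗ var ∘ liftᵣ f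
liftₛ-var f zero    = refl
liftₛ-var f (suc i) = refl

sub-var : sub {n} var ≗ id
sub-var-lift : sub (liftₛ {n} var) ≗ id

sub-var (t ≐ u) = cong₂ _≐_ (subᵗ-var t) (subᵗ-var u)
sub-var (t ≦ u) = cong₂ _≦_ (subᵗ-var t) (subᵗ-var u)
sub-var (~ φ)   = cong ~_ (sub-var φ)
sub-var (φ ∧ ψ) = cong₂ _∧_ (sub-var φ) (sub-var ψ)
sub-var (φ ∨ ψ) = cong₂ _∨_ (sub-var φ) (sub-var ψ)
sub-var (φ ⇒ ψ) = cong₂ _⇒_ (sub-var φ) (sub-var ψ)
sub-var (all φ) = cong all (sub-var-lift φ)
sub-var (ex φ)  = cong ex (sub-var-lift φ)

sub-var-lift φ = trans (sub-cong (λ { zero → refl ; (suc i) → refl }) φ) (sub-var φ)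

-- Seeing renamings as substitutions leaves `subᵗ-subᵗ` and `sub-sub` as the only composition laws
-- that need an induction; the mixed laws are corollaries.
ren≡sub : (f : Fin m → Fin n) → ren f ≗ sub (var ∘ f)
ren≡sub f (t ≐ u) = cong₂ _≐_ (renᵗ≡subᵗ t) (renᵗ≡subᵗ u)
ren≡sub f (t ≦ u) = cong₂ _≦_ (renᵗ≡subᵗ t) (renᵗ≡subᵗ u)
ren≡sub f (~ φ)   = cong ~_ (ren≡sub f φ)
ren≡sub f (φ ∧ ψ) = cong₂ _∧_ (ren≡sub f φ) (ren≡sub f ψ)
ren≡sub f (φ ∨ ψ) = cong₂ _∨_ (ren≡sub f φ) (ren≡sub f ψ)
ren≡sub f (φ ⇒ ψ) = cong₂ _⇒_ (ren≡sub f φ) (ren≡sub f ψ)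
ren≡sub f (all φ) =
  cong all (trans (ren≡sub (liftᵣ f) φ) (sym (sub-cong (liftₛ-var f) φ)))
ren≡sub f (ex φ)  =
  cong ex (trans (ren≡sub (liftᵣ f) φ) (sym (sub-cong (liftₛ-var f) φ)))

subᵗ-subᵗ : (τ : Fin m → Term n) (σ : Fin l → Term m) → subᵗ τ ∘ subᵗ σ ≗ subᵗ (subᵗ τ ∘ σ)
subᵗ-subᵗ τ σ (var i) = refl
subᵗ-subᵗ τ σ 𝟘       = refl
subᵗ-subᵗ τ σ (𝗌 t)   = cong 𝗌 (subᵗ-subᵗ τ σ t)
subᵗ-subᵗ τ σ (t ⊕ u) = cong₂ _⊕_ (subᵗ-subᵗ τ σ t) (subᵗ-subᵗ τ σ u)
subᵗ-subᵗ τ σ (t ⊗ u) = cong₂ _⊗_ (subᵗ-subᵗ τ σ t) (subᵗ-subᵗ τ σ u)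

subᵗ-renᵗ : (τ : Fin m → Term n) (f : Fin l → Fin m) → subᵗ τ ∘ renᵗ f ≗ subᵗ (τ ∘ f)
subᵗ-renᵗ τ f t = trans (cong (subᵗ τ) (renᵗ≡subᵗ t)) (subᵗ-subᵗ τ (var ∘ f) t)

renᵗ-subᵗ : (f : Fin m → Fin n) (σ : Fin l → Term m) → renᵗ f ∘ subᵗ σ ≗ subᵗ (renᵗ f ∘ σ)
renᵗ-subᵗ f σ t = trans (renᵗ≡subᵗ (subᵗ σ t))
  (trans (subᵗ-subᵗ (var ∘ f) σ t) (sym (subᵗ-cong (renᵗ≡subᵗ ∘ σ) t)))

subᵗ-liftₛ-wkᵗ : (σ : Fin m → Term n) → subᵗ (liftₛ σ) ∘ wkᵗ ≗ wkᵗ ∘ subᵗ σ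
subᵗ-liftₛ-wkᵗ σ t = trans (subᵗ-renᵗ (liftₛ σ) suc t) (sym (renᵗ-subᵗ suc σ t))

liftₛ-∘ : (τ : Fin m → Term n) (σ : Fin l → Term m) →
          subᵗ (liftₛ τ) ∘ liftₛ σ ≗ liftₛ (subᵗ τ ∘ σ)
liftₛ-∘ τ σ zero    = refl
liftₛ-∘ τ σ (suc i) = subᵗ-liftₛ-wkᵗ τ (σ i)

sub-sub : (τ : Fin m → Term n) (σ : Fin l → Term m) → sub τ ∘ sub σ ≗ sub (subᵗ τ ∘ σ)
sub-sub τ σ (t ≐ u) = cong₂ _≐_ (subᵗ-subᵗ τ σ t) (subᵗ-subᵗ τ σ u)
sub-sub τ σ (t ≦ u) = cong₂ _≦_ (subᵗ-subᵗ τ σ t) (subᵗ-subᵗ τ σ u)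
sub-sub τ σ (~ φ)   = cong ~_ (sub-sub τ σ φ)
sub-sub τ σ (φ ∧ ψ) = cong₂ _∧_ (sub-sub τ σ φ) (sub-sub τ σ ψ)
sub-sub τ σ (φ ∨ ψ) = cong₂ _∨_ (sub-sub τ σ φ) (sub-sub τ σ ψ)
sub-sub τ σ (φ ⇒ ψ) = cong₂ _⇒_ (sub-sub τ σ φ) (sub-sub τ σ ψ)
sub-sub τ σ (all φ) =
  cong all (trans (sub-sub (liftₛ τ) (liftₛ σ) φ) (sub-cong (liftₛ-∘ τ σ) φ))
sub-sub τ σ (ex φ)  =
  cong ex (trans (sub-sub (liftₛ τ) (liftₛ σ) φ) (sub-cong (liftₛ-∘ τ σ) φ))

sub-ren : (τ : Fin m → Term n) (f : Fin l → Fin m) → sub τ ∘ ren f ≗ sub (τ ∘ f)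
sub-ren τ f φ = trans (cong (sub τ) (ren≡sub f φ)) (sub-sub τ (var ∘ f) φ)

ren-sub : (f : Fin m → Fin n) (σ : Fin l → Term m) → ren f ∘ sub σ ≗ sub (renᵗ f ∘ σ)
ren-sub f σ φ = trans (ren≡sub f (sub σ φ))
  (trans (sub-sub (var ∘ f) σ φ) (sym (sub-cong (renᵗ≡subᵗ ∘ σ) φ)))

-- The rule `ax` concludes `inContext σ` even in the empty context, where this is not definitionally
-- `σ`.
inContext-sentence : (φ : Sentence) → inContext φ ≡ φ
inContext-sentence φ = trans (ren≡sub _ φ) (trans (sub-cong (λ ()) φ) (sub-var φ))

wkᵗ-inst : (u t : Term n) → subᵗ (inst u) (wkᵗ t) ≡ t
wkᵗ-inst u t = trans (subᵗ-renᵗ (inst u) suc t) (subᵗ-var t)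

⟨⟩≡[] : (φ : Formula 1) (t : Term 0) → φ ⟨ t ⟩ ≡ φ [ t ]
⟨⟩≡[] φ t = sub-cong (λ { zero → refl }) φ

liftᵣ-wk-inst : (φ : Formula (suc n)) (t : Term n) →
                ren (liftᵣ suc) φ [ wkᵗ t ] ≡ wk (φ [ t ])
liftᵣ-wk-inst φ t = trans (sub-ren _ _ φ)
  (trans (sub-cong (λ { zero → refl ; (suc i) → refl }) φ) (sym (ren-sub suc (inst t) φ)))

-- The composite substitution fixes every variable. Needed to open a weakened universal formula at
-- the fresh variable.
liftᵣ-wk-x₀ : (φ : Formula (suc n)) → ren (liftᵣ suc) φ [ x₀ ] ≡ φ
liftᵣ-wk-x₀ φ = trans (sub-ren _ _ φ)
  (trans (sub-cong (λ { zero → refl ; (suc i) → refl }) φ) (sub-var φ))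

renᵗ-numeral : (f : Fin m → Fin n) (k : ℕ) → renᵗ f (numeral k) ≡ numeral k
renᵗ-numeral f zero    = refl
renᵗ-numeral f (suc k) = cong 𝗌 (renᵗ-numeral f k)

num : Vector ℕ m → Fin m → Term n
num ρ i = numeral (ρ i)

wkᵗ-num : (ρ : Vector ℕ m) (t : Term m) → wkᵗ (subᵗ (num {n = n} ρ) t) ≡ subᵗ (num ρ) t
wkᵗ-num ρ t = trans (renᵗ-subᵗ suc (num ρ) t) (subᵗ-cong (λ i → renᵗ-numeral suc (ρ i)) t)

-- The instantiation cancels the weakening that `liftₛ` applies to the numerals of `ρ`. Inductions
-- on formulas can thus pass a quantifier by enlarging the environment.
num-∷ : (k : ℕ) (ρ : Vector ℕ m) (φ : Formula (suc m)) →
        sub (liftₛ (num {n = n} ρ)) φ [ numeral k ] ≡ sub (num (k Vector.∷ ρ)) φ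
num-∷ k ρ φ = trans (sub-sub _ _ φ)
  (sub-cong (λ { zero → refl ; (suc i) → wkᵗ-inst (numeral k) (num ρ i) }) φ)

-- Natural deduction

weaken : Γ ⊆ Δ → T ∣ Γ ⊢ φ → T ∣ Δ ⊢ φ
weaken s (ax a)     = ax a
weaken s (hyp i)    = hyp (s i)
weaken s (¬I d e)   = ¬I (weaken (∷⁺ʳ _ s) d) (weaken (∷⁺ʳ _ s) e)
weaken s (¬E d e)   = ¬E (weaken s d) (weaken s e)
weaken s lem        = lem
weaken s (∧I d e)   = ∧I (weaken s d) (weaken s e)
weaken s (∧E₁ d)    = ∧E₁ (weaken s d)
weaken s (∧E₂ d)    = ∧E₂ (weaken s d)
weaken s (∨I₁ d)    = ∨I₁ (weaken s d)
weaken s (∨I₂ d)    = ∨I₂ (weaken s d)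
weaken s (∨E d e f) = ∨E (weaken s d) (weaken (∷⁺ʳ _ s) e) (weaken (∷⁺ʳ _ s) f)
weaken s (⇒I d)     = ⇒I (weaken (∷⁺ʳ _ s) d)
weaken s (⇒E d e)   = ⇒E (weaken s d) (weaken s e)
weaken s (∀I d)     = ∀I (weaken (map⁺ wk s) d)
weaken s (∀E t d)   = ∀E t (weaken s d)
weaken s (∃I t d)   = ∃I t (weaken s d)
weaken s (∃E d e)   = ∃E (weaken s d) (weaken (∷⁺ʳ _ (map⁺ wk s)) e)
weaken s ≐I         = ≐I
weaken s (≐E φ d e) = ≐E φ (weaken s d) (weaken s e)

weaken₁ : T ∣ Γ ⊢ φ → T ∣ ψ ∷ Γ ⊢ φ
weaken₁ = weaken (xs⊆x∷xs _ _)

weaken-[] : T ⊢ φ → T ∣ Γ ⊢ φ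
weaken-[] = weaken λ ()

hyp₀ : T ∣ φ ∷ Γ ⊢ φ
hyp₀ = hyp (here refl)

hyp₁ : T ∣ ψ ∷ φ ∷ Γ ⊢ φ
hyp₁ = hyp (there (here refl))

hyp₂ : T ∣ χ ∷ ψ ∷ φ ∷ Γ ⊢ φ
hyp₂ = hyp (there (there (here refl)))

cut : T ∣ Γ ⊢ φ → T ∣ φ ∷ Γ ⊢ ψ → T ∣ Γ ⊢ ψ
cut d e = ⇒E (⇒I e) d

contrapose : T ∣ Γ ⊢ φ ⇒ ψ → T ∣ Γ ⊢ ~ ψ → T ∣ Γ ⊢ ~ φ
contrapose d e = ¬I (⇒E (weaken₁ d) hyp₀) (weaken₁ e)

≡⇒⊢ : φ ≡ ψ → T ∣ Γ ⊢ φ → T ∣ Γ ⊢ ψ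
≡⇒⊢ refl d = d

∀E-x₀ : T ∣ Γ ⊢ wk (all φ) → T ∣ Γ ⊢ φ
∀E-x₀ {φ = φ} d = ≡⇒⊢ (liftᵣ-wk-x₀ φ) (∀E x₀ d)

-- `weaken` changes the hypotheses but not the scope, so derivations cannot be moved under `∀I`
-- directly. Cutting turns the premises into hypotheses, which `∀I` weakens by itself.
∀-map₂ : (∀ {Δ} → T ∣ Δ ⊢ φ → T ∣ Δ ⊢ ψ → T ∣ Δ ⊢ χ) →
         T ∣ Γ ⊢ all φ → T ∣ Γ ⊢ all ψ → T ∣ Γ ⊢ all χ
∀-map₂ f d e = cut d (cut (weaken₁ e) (∀I (f (∀E-x₀ hyp₁) (∀E-x₀ hyp₀))))

∀-⇒-trans : T ∣ Γ ⊢ all (φ ⇒ ψ) → T ∣ Γ ⊢ all (ψ ⇒ χ) → T ∣ Γ ⊢ all (φ ⇒ χ)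
∀-⇒-trans = ∀-map₂ λ d e → ⇒I (⇒E (weaken₁ e) (⇒E (weaken₁ d) hyp₀))

∀-∨ : T ∣ Γ ⊢ all (φ ⇒ χ) → T ∣ Γ ⊢ all (ψ ⇒ χ) → T ∣ Γ ⊢ all (φ ∨ ψ ⇒ χ)
∀-∨ = ∀-map₂ λ d e →
  ⇒I (∨E hyp₀ (⇒E (weaken₁ (weaken₁ d)) hyp₀) (⇒E (weaken₁ (weaken₁ e)) hyp₀))

∀¬⇒¬∃ : T ∣ Γ ⊢ all (φ ⇒ ~ ψ) → T ∣ Γ ⊢ ~ ex (φ ∧ ψ)
-- The contradiction found under `∃E` mentions the witness and cannot leave its scope, so an
-- arbitrary `χ` is derived from it; `¬I` receives `𝟘 ≐ 𝟘` and its negation.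
∀¬⇒¬∃ {T = T} {Γ = Γ} {φ = φ} {ψ = ψ} d = cut d (¬I (absurd (𝟘 ≐ 𝟘)) (absurd (~ (𝟘 ≐ 𝟘))))
  where
  absurd : ∀ χ → T ∣ ex (φ ∧ ψ) ∷ all (φ ⇒ ~ ψ) ∷ Γ ⊢ χ
  absurd χ = ∃E {χ = χ} hyp₀ (¬E (∧E₂ hyp₀) (⇒E (∀E-x₀ {φ = φ ⇒ ~ ψ} hyp₂) (∧E₁ hyp₀)))

≐-sym : T ∣ Γ ⊢ t ≐ u → T ∣ Γ ⊢ u ≐ t
≐-sym {t = t} {u} d = ≡⇒⊢ (cong (u ≐_) (wkᵗ-inst u t))
  (≐E (x₀ ≐ wkᵗ t) d (≡⇒⊢ (cong (t ≐_) (sym (wkᵗ-inst t t))) ≐I))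

≐-trans : T ∣ Γ ⊢ t ≐ u → T ∣ Γ ⊢ u ≐ v → T ∣ Γ ⊢ t ≐ v
≐-trans {t = t} {u} {v} d e = ≡⇒⊢ (cong (_≐ v) (wkᵗ-inst v t))
  (≐E (wkᵗ t ≐ x₀) e (≡⇒⊢ (cong (_≐ u) (sym (wkᵗ-inst u t))) d))

-- Rewriting in `wkᵗ s[t] ≐ s` starts from reflexivity; the weakened copy lacks the replaced
-- variable and stays fixed.
≐-cong : (s : Term (suc n)) {t u : Term n} → T ∣ Γ ⊢ t ≐ u →
         T ∣ Γ ⊢ subᵗ (inst t) s ≐ subᵗ (inst u) s
≐-cong s {t} {u} d = ≡⇒⊢ (cong (_≐ subᵗ (inst u) s) (wkᵗ-inst u s[t]))
  (≐E (wkᵗ s[t] ≐ s) d (≡⇒⊢ (cong (_≐ s[t]) (sym (wkᵗ-inst t s[t]))) ≐I))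
  where
  s[t] = subᵗ (inst t) s

𝗌-cong : T ∣ Γ ⊢ t ≐ u → T ∣ Γ ⊢ 𝗌 t ≐ 𝗌 u
𝗌-cong = ≐-cong (𝗌 x₀)

⊕-congˡ : (s : Term n) → T ∣ Γ ⊢ t ≐ u → T ∣ Γ ⊢ s ⊕ t ≐ s ⊕ u
⊕-congˡ {t = t} {u} s d =
  ≡⇒⊢ (cong₂ (λ a b → a ⊕ t ≐ b ⊕ u) (wkᵗ-inst t s) (wkᵗ-inst u s)) (≐-cong (wkᵗ s ⊕ x₀) d)

⊕-congʳ : (s : Term n) → T ∣ Γ ⊢ t ≐ u → T ∣ Γ ⊢ t ⊕ s ≐ u ⊕ s
⊕-congʳ {t = t} {u} s d =
  ≡⇒⊢ (cong₂ (λ a b → t ⊕ a ≐ u ⊕ b) (wkᵗ-inst t s) (wkᵗ-inst u s)) (≐-cong (x₀ ⊕ wkᵗ s) d)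

⊗-congˡ : (s : Term n) → T ∣ Γ ⊢ t ≐ u → T ∣ Γ ⊢ s ⊗ t ≐ s ⊗ u
⊗-congˡ {t = t} {u} s d =
  ≡⇒⊢ (cong₂ (λ a b → a ⊗ t ≐ b ⊗ u) (wkᵗ-inst t s) (wkᵗ-inst u s)) (≐-cong (wkᵗ s ⊗ x₀) d)

⊗-congʳ : (s : Term n) → T ∣ Γ ⊢ t ≐ u → T ∣ Γ ⊢ t ⊗ s ≐ u ⊗ s
⊗-congʳ {t = t} {u} s d =
  ≡⇒⊢ (cong₂ (λ a b → t ⊗ a ≐ u ⊗ b) (wkᵗ-inst t s) (wkᵗ-inst u s)) (≐-cong (x₀ ⊗ wkᵗ s) d)

≦-resp : ∀ {t′ u′ : Term n} → T ∣ Γ ⊢ t ≐ t′ → T ∣ Γ ⊢ u ≐ u′ → T ∣ Γ ⊢ t ≦ u → T ∣ Γ ⊢ t′ ≦ u′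
≦-resp {t = t} {u} {t′} {u′} d e f = ≡⇒⊢ (cong (_≦ u′) (wkᵗ-inst u′ t′))
  (≐E (wkᵗ t′ ≦ x₀) e
    (≡⇒⊢ (cong₂ _≦_ (sym (wkᵗ-inst u t′)) (wkᵗ-inst t′ u))
      (≐E (x₀ ≦ wkᵗ u) d (≡⇒⊢ (cong (t ≦_) (sym (wkᵗ-inst t u))) f))))

-- The one-point rule: under the binder, the equation read backwards turns `wkᵗ t` into `x₀` in the
-- weakened `φ [ t ]`.
∀-≐ : T ∣ Γ ⊢ φ [ t ] → T ∣ Γ ⊢ all (x₀ ≐ wkᵗ t ⇒ φ)
∀-≐ {φ = φ} {t = t} d = cut d (∀I (⇒I (≡⇒⊢ (liftᵣ-wk-x₀ φ)
  (≐E (ren (liftᵣ suc) φ) (≐-sym hyp₀) (≡⇒⊢ (sym (liftᵣ-wk-inst φ t)) hyp₁)))))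

-- Semantics in ℕ

⟦_⟧ᵗ : Term n → Vector ℕ n → ℕ
⟦ var i ⟧ᵗ ρ = ρ i
⟦ 𝟘 ⟧ᵗ     ρ = 0
⟦ 𝗌 t ⟧ᵗ   ρ = suc (⟦ t ⟧ᵗ ρ)
⟦ t ⊕ u ⟧ᵗ ρ = ⟦ t ⟧ᵗ ρ ℕ.+ ⟦ u ⟧ᵗ ρ
⟦ t ⊗ u ⟧ᵗ ρ = ⟦ t ⟧ᵗ ρ ℕ.* ⟦ u ⟧ᵗ ρ

⟦_⟧ : Formula n → Vector ℕ n → Set
⟦ t ≐ u ⟧ ρ = ⟦ t ⟧ᵗ ρ ≡ ⟦ u ⟧ᵗ ρ
⟦ t ≦ u ⟧ ρ = ⟦ t ⟧ᵗ ρ ≤ ⟦ u ⟧ᵗ ρ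
⟦ ~ φ ⟧   ρ = ¬ ⟦ φ ⟧ ρ
⟦ φ ∧ ψ ⟧ ρ = ⟦ φ ⟧ ρ × ⟦ ψ ⟧ ρ
⟦ φ ∨ ψ ⟧ ρ = ⟦ φ ⟧ ρ ⊎ ⟦ ψ ⟧ ρ
⟦ φ ⇒ ψ ⟧ ρ = ⟦ φ ⟧ ρ → ⟦ ψ ⟧ ρ
⟦ all φ ⟧ ρ = ∀ k → ⟦ φ ⟧ (k Vector.∷ ρ)
⟦ ex φ ⟧  ρ = ∃ λ k → ⟦ φ ⟧ (k Vector.∷ ρ)

⟦renᵗ⟧ : (f : Fin m → Fin n) (t : Term m) {ρ : Vector ℕ n} → ⟦ renᵗ f t ⟧ᵗ ρ ≡ ⟦ t ⟧ᵗ (ρ ∘ f)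
⟦renᵗ⟧ f (var i) = refl
⟦renᵗ⟧ f 𝟘       = refl
⟦renᵗ⟧ f (𝗌 t)   = cong suc (⟦renᵗ⟧ f t)
⟦renᵗ⟧ f (t ⊕ u) = cong₂ ℕ._+_ (⟦renᵗ⟧ f t) (⟦renᵗ⟧ f u)
⟦renᵗ⟧ f (t ⊗ u) = cong₂ ℕ._*_ (⟦renᵗ⟧ f t) (⟦renᵗ⟧ f u)

-- Evidence comes with either outcome, which settles bounded quantifiers without excluded middle in
-- the metatheory.
bounded-search : {P Q : Pred ℕ 0ℓ} → (∀ k → P k ⊎ Q k) →
                 ∀ b → (∀ k → k ≤ b → P k) ⊎ (∃ λ k → k ≤ b × Q k)
bounded-search p⊎q zero = Sum.map (λ { p _ z≤n → p }) (λ q → 0 , z≤n , q) (p⊎q 0)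
bounded-search p⊎q (suc b) with p⊎q 0 | bounded-search (p⊎q ∘ suc) b
... | inj₂ q | _                  = inj₂ (0 , z≤n , q)
... | inj₁ _ | inj₂ (k , k≤b , q) = inj₂ (suc k , s≤s k≤b , q)
... | inj₁ p | inj₁ ps            = inj₁ λ { zero _ → p ; (suc k) (s≤s k≤b) → ps k k≤b }

-- Σ₁-completeness

-- Replaces `t ≦ numeral b` by a finite disjunction of equations, so that a bounded universal
-- formula can be treated one numeral at a time.
below : ℕ → Term n → Formula n
below zero    t = t ≐ 𝟘
below (suc b) t = below b t ∨ t ≐ numeral (suc b)

wk-below : (b : ℕ) (t : Term n) → wk (below b t) ≡ below b (wkᵗ t)
wk-below zero    t = refl
wk-below (suc b) t = cong₂ (λ φ s → φ ∨ wkᵗ t ≐ s) (wk-below b t) (renᵗ-numeral suc (suc b))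

≐𝟘⇒below : (b : ℕ) → T ∣ Γ ⊢ t ≐ 𝟘 → T ∣ Γ ⊢ below b t
≐𝟘⇒below zero    d = d
≐𝟘⇒below (suc b) d = ∨I₁ (≐𝟘⇒below b d)

below-𝗌 : (b : ℕ) → T ∣ Γ ⊢ t ≐ 𝗌 u → T ∣ Γ ⊢ below b u → T ∣ Γ ⊢ below (suc b) t
below-𝗌 zero    d e = ∨I₂ (≐-trans d (𝗌-cong e))
below-𝗌 (suc b) d e = ∨E e (∨I₁ (below-𝗌 b (weaken₁ d) hyp₀))
                           (∨I₂ (≐-trans (weaken₁ d) (𝗌-cong hyp₀)))

∀-below : (b : ℕ) → (∀ k → k ≤ b → T ∣ Γ ⊢ φ [ numeral k ]) → T ∣ Γ ⊢ all (below b x₀ ⇒ φ)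
∀-below {φ = φ} zero    d = ∀-≐ {φ = φ} (d 0 z≤n)
∀-below {φ = φ} (suc b) d = ∀-∨
  (∀-below b λ k k≤b → d k (ℕ.m≤n⇒m≤1+n k≤b))
  (≡⇒⊢ (cong (λ s → all (x₀ ≐ s ⇒ φ)) (renᵗ-numeral suc (suc b))) (∀-≐ {φ = φ} (d (suc b) ≤-refl)))

-- Numerals, order and closed terms in extensions of PA

module Arithmetic {T : Theory} (PA⊆T : ∀ {σ} → PA σ → T σ) where

  𝗌≢𝟘 : (t : Term n) → T ∣ Γ ⊢ ~ (𝗌 t ≐ 𝟘)
  𝗌≢𝟘 t = ∀E t (ax (PA⊆T s≢0))

  𝗌-inj : T ∣ Γ ⊢ 𝗌 t ≐ 𝗌 u → T ∣ Γ ⊢ t ≐ u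
  𝗌-inj {t = t} {u} d =
    ⇒E (≡⇒⊢ (cong (λ s → 𝗌 s ≐ 𝗌 u ⇒ s ≐ u) (wkᵗ-inst u t)) (∀E u (∀E t (ax (PA⊆T s-inj))))) d

  ⊕-𝟘 : (t : Term n) → T ∣ Γ ⊢ t ⊕ 𝟘 ≐ t
  ⊕-𝟘 t = ∀E t (ax (PA⊆T +-0))

  ⊕-𝗌 : (t u : Term n) → T ∣ Γ ⊢ t ⊕ 𝗌 u ≐ 𝗌 (t ⊕ u)
  ⊕-𝗌 t u = ≡⇒⊢ (cong (λ s → s ⊕ 𝗌 u ≐ 𝗌 (s ⊕ u)) (wkᵗ-inst u t)) (∀E u (∀E t (ax (PA⊆T +-s))))

  ⊗-𝟘 : (t : Term n) → T ∣ Γ ⊢ t ⊗ 𝟘 ≐ 𝟘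
  ⊗-𝟘 t = ∀E t (ax (PA⊆T ×-0))

  ⊗-𝗌 : (t u : Term n) → T ∣ Γ ⊢ t ⊗ 𝗌 u ≐ t ⊗ u ⊕ t
  ⊗-𝗌 t u = ≡⇒⊢ (cong (λ s → s ⊗ 𝗌 u ≐ s ⊗ u ⊕ s) (wkᵗ-inst u t)) (∀E u (∀E t (ax (PA⊆T ×-s))))

  ≦-def : (t u : Term n) → T ∣ Γ ⊢ t ≦ u ⟺ ex (x₀ ⊕ wkᵗ t ≐ wkᵗ u)
  ≦-def t u = ≡⇒⊢
    (cong₂ (λ a b → a ≦ u ⟺ ex (x₀ ⊕ b ≐ wkᵗ u)) (wkᵗ-inst u t)
      (trans (subᵗ-liftₛ-wkᵗ (inst u) (wkᵗ t)) (cong wkᵗ (wkᵗ-inst u t))))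
    (∀E u (∀E t (ax (PA⊆T ≤-def))))

  -- The case distinction of Robinson arithmetic, and the one place where the induction scheme
  -- enters.
  zero-or-suc : (t : Term n) → T ∣ Γ ⊢ t ≐ 𝟘 ∨ ex (wkᵗ t ≐ 𝗌 x₀)
  zero-or-suc t = ∀E t (⇒E (ax (PA⊆T (ind {0} (x₀ ≐ 𝟘 ∨ ex (x₁ ≐ 𝗌 x₀)))))
    (∧I (∨I₁ ≐I) (∀I (⇒I (∨I₂ (∃I x₀ ≐I))))))

  -- Recursion on the number `b`, outside the theory. If `t` is `𝗌 u`, then `𝗌 (s ⊕ u) ≐ numeral b`:
  -- absurd for `b = 0`, and otherwise cancelling one `𝗌` leads to `u` and the predecessor of `b`.
  summand-below : (b : ℕ) (s t : Term n) → T ∣ Γ ⊢ s ⊕ t ≐ numeral b ⇒ below b t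
  summand-below b s t = ⇒I (∨E (zero-or-suc t) (≐𝟘⇒below b hyp₀)
    (∃E hyp₀ (≡⇒⊢ (sym (wk-below b t)) (successor b
      hyp₀
      (≡⇒⊢ (cong (wkᵗ s ⊕ wkᵗ t ≐_) (renᵗ-numeral suc b)) hyp₂)))))
    where
    successor : ∀ {n} {Γ : List (Formula n)} {s t u} b →
                T ∣ Γ ⊢ t ≐ 𝗌 u → T ∣ Γ ⊢ s ⊕ t ≐ numeral b → T ∣ Γ ⊢ below b t
    successor {s = s} {t} {u} b t≐𝗌u s⊕t≐b =
      finish b (≐-trans (≐-sym (≐-trans (⊕-congˡ s t≐𝗌u) (⊕-𝗌 s u))) s⊕t≐b)
      where
      finish : ∀ b → T ∣ _ ⊢ 𝗌 (s ⊕ u) ≐ numeral b → T ∣ _ ⊢ below b t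
      finish zero    d = ¬E d (𝗌≢𝟘 (s ⊕ u))
      finish (suc b) d = below-𝗌 b t≐𝗌u (⇒E (summand-below b s u) (𝗌-inj d))

  ≦⇒below : (b : ℕ) → T ∣ Γ ⊢ t ≦ numeral b → T ∣ Γ ⊢ below b t
  ≦⇒below {t = t} b d = ∃E (⇒E (∧E₁ (≦-def t (numeral b))) d)
    (≡⇒⊢ (sym (wk-below b t)) (⇒E (summand-below b x₀ (wkᵗ t))
      (≡⇒⊢ (cong (x₀ ⊕ wkᵗ t ≐_) (renᵗ-numeral suc b)) hyp₀)))

  numeral-⊕ : (a b : ℕ) → T ∣ Γ ⊢ numeral a ⊕ numeral b ≐ numeral (a ℕ.+ b)
  numeral-⊕ a zero    rewrite ℕ.+-identityʳ a = ⊕-𝟘 (numeral a)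
  numeral-⊕ a (suc b) rewrite ℕ.+-suc a b =
    ≐-trans (⊕-𝗌 (numeral a) (numeral b)) (𝗌-cong (numeral-⊕ a b))

  numeral-⊗ : (a b : ℕ) → T ∣ Γ ⊢ numeral a ⊗ numeral b ≐ numeral (a ℕ.* b)
  numeral-⊗ a zero    rewrite ℕ.*-zeroʳ a = ⊗-𝟘 (numeral a)
  numeral-⊗ a (suc b) rewrite ℕ.*-suc a b | ℕ.+-comm a (a ℕ.* b) =
    ≐-trans (⊗-𝗌 (numeral a) (numeral b))
      (≐-trans (⊕-congʳ (numeral a) (numeral-⊗ a b)) (numeral-⊕ (a ℕ.* b) a))

  numeral-≢ : {a b : ℕ} → a ≢ b → T ∣ Γ ⊢ ~ (numeral a ≐ numeral b)
  numeral-≢ {a = zero}  {zero}  a≢b = contradiction refl a≢b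
  numeral-≢ {a = zero}  {suc b} a≢b = ¬I (≐-sym hyp₀) (𝗌≢𝟘 (numeral b))
  numeral-≢ {a = suc a} {zero}  a≢b = 𝗌≢𝟘 (numeral a)
  numeral-≢ {a = suc a} {suc b} a≢b = ¬I (𝗌-inj hyp₀) (numeral-≢ (a≢b ∘ cong suc))

  numeral-≦ : {a b : ℕ} → a ≤ b → T ∣ Γ ⊢ numeral a ≦ numeral b
  numeral-≦ {a = a} {b} a≤b = ⇒E (∧E₂ (≦-def (numeral a) (numeral b)))
    (∃I (numeral (b ℕ.∸ a))
      (≡⇒⊢ (cong₂ (λ s t → numeral (b ℕ.∸ a) ⊕ s ≐ t)
              (sym (wkᵗ-inst _ (numeral a)))
              (trans (cong numeral (ℕ.m∸n+n≡m a≤b)) (sym (wkᵗ-inst _ (numeral b)))))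
        (numeral-⊕ (b ℕ.∸ a) a)))

  below-absurd : {a b : ℕ} → b ℕ.< a → T ∣ Γ ⊢ below b (numeral a) → T ∣ Γ ⊢ φ
  below-absurd {b = zero}  b<a d = ¬E d (numeral-≢ (ℕ.>⇒≢ b<a))
  below-absurd {b = suc b} b<a d = ∨E d
    (below-absurd (ℕ.<-trans (ℕ.n<1+n b) b<a) hyp₀)
    (¬E hyp₀ (numeral-≢ (ℕ.>⇒≢ b<a)))

  numeral-≰ : {a b : ℕ} → ¬ a ≤ b → T ∣ Γ ⊢ ~ (numeral a ≦ numeral b)
  numeral-≰ {b = b} a≰b = ¬I {ψ = 𝟘 ≐ 𝟘} ≐I (below-absurd (ℕ.≰⇒> a≰b) (≦⇒below b hyp₀))

  term-value : (ρ : Vector ℕ m) (t : Term m) → T ∣ Γ ⊢ subᵗ (num ρ) t ≐ numeral (⟦ t ⟧ᵗ ρ)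
  term-value ρ (var i) = ≐I
  term-value ρ 𝟘       = ≐I
  term-value ρ (𝗌 t)   = 𝗌-cong (term-value ρ t)
  term-value ρ (t ⊕ u) =
    ≐-trans (⊕-congʳ _ (term-value ρ t)) (≐-trans (⊕-congˡ _ (term-value ρ u)) (numeral-⊕ _ _))
  term-value ρ (t ⊗ u) =
    ≐-trans (⊗-congʳ _ (term-value ρ t)) (≐-trans (⊗-congˡ _ (term-value ρ u)) (numeral-⊗ _ _))

  -- Truth in ℕ and derivability in `T` travel together, and both outcomes are kept because `~` and
  -- the left side of `⇒` exchange them.
  Decision : Vector ℕ m → Formula m → Set
  Decision ρ φ = (⟦ φ ⟧ ρ × (T ⊢ sub (num {n = 0} ρ) φ)) ⊎ (¬ ⟦ φ ⟧ ρ × (T ⊢ ~ sub (num {n = 0} ρ) φ))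

  sub-all≤ : (ρ : Vector ℕ m) (t : Term m) (φ : Formula (suc m)) →
             sub (num {n = n} ρ) (all≤ t φ) ≡ all≤ (subᵗ (num ρ) t) (sub (liftₛ (num ρ)) φ)
  sub-all≤ ρ t φ = cong (λ s → all (x₀ ≦ s ⇒ _)) (subᵗ-liftₛ-wkᵗ (num ρ) t)

  sub-ex≤ : (ρ : Vector ℕ m) (t : Term m) (φ : Formula (suc m)) →
            sub (num {n = n} ρ) (ex≤ t φ) ≡ ex≤ (subᵗ (num ρ) t) (sub (liftₛ (num ρ)) φ)
  sub-ex≤ ρ t φ = cong (λ s → ex (x₀ ≦ s ∧ _)) (subᵗ-liftₛ-wkᵗ (num ρ) t)

  -- Inside `T` the bound is first evaluated to a numeral; `≦⇒below` then leaves finitely many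
  -- instances.
  ∀≤-intro : (ρ : Vector ℕ m) (t : Term m) → (∀ k → k ≤ ⟦ t ⟧ᵗ ρ → T ∣ Γ ⊢ φ [ numeral k ]) →
             T ∣ Γ ⊢ all≤ (subᵗ (num ρ) t) φ
  ∀≤-intro ρ t d = ∀-⇒-trans
    (∀I (⇒I (≦⇒below (⟦ t ⟧ᵗ ρ)
      (≦-resp ≐I (≡⇒⊢ (cong (_≐ numeral (⟦ t ⟧ᵗ ρ)) (sym (wkᵗ-num ρ t))) (term-value ρ t)) hyp₀))))
    (∀-below (⟦ t ⟧ᵗ ρ) d)

  ≦-intro : (ρ : Vector ℕ m) (t : Term m) {k : ℕ} → k ≤ ⟦ t ⟧ᵗ ρ →
            T ∣ Γ ⊢ numeral k ≦ subᵗ (inst (numeral k)) (wkᵗ (subᵗ (num ρ) t))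
  ≦-intro ρ t {k} k≤t = ≡⇒⊢ (cong (numeral k ≦_) (sym (wkᵗ-inst _ (subᵗ (num ρ) t))))
    (≦-resp ≐I (≐-sym (term-value ρ t)) (numeral-≦ k≤t))

  Δ₀-decision : Δ₀ φ → (ρ : Vector ℕ m) → Decision ρ φ
  Δ₀-decision (eq t u) ρ with ⟦ t ⟧ᵗ ρ ℕ.≟ ⟦ u ⟧ᵗ ρ
  ... | yes e = inj₁ (e , ≐-trans (term-value ρ t)
          (≡⇒⊢ (cong (λ a → numeral a ≐ subᵗ (num ρ) u) (sym e)) (≐-sym (term-value ρ u))))
  ... | no ¬e = inj₂ (¬e , contrapose
          (⇒I (≐-trans (≐-sym (term-value ρ t)) (≐-trans hyp₀ (term-value ρ u)))) (numeral-≢ ¬e))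
  Δ₀-decision (le t u) ρ with ⟦ t ⟧ᵗ ρ ℕ.≤? ⟦ u ⟧ᵗ ρ
  ... | yes p = inj₁ (p , ≦-resp (≐-sym (term-value ρ t)) (≐-sym (term-value ρ u)) (numeral-≦ p))
  ... | no ¬p = inj₂ (¬p , contrapose
          (⇒I (≦-resp (term-value ρ t) (term-value ρ u) hyp₀)) (numeral-≰ ¬p))
  Δ₀-decision (neg φ) ρ with Δ₀-decision φ ρ
  ... | inj₁ (p , d)  = inj₂ ((λ ¬p → ¬p p) , ¬I (weaken₁ d) hyp₀)
  ... | inj₂ (¬p , d) = inj₁ (¬p , d)
  Δ₀-decision (and φ ψ) ρ with Δ₀-decision φ ρ | Δ₀-decision ψ ρ
  ... | inj₁ (p , d)  | inj₁ (q , e)  = inj₁ ((p , q) , ∧I d e)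
  ... | inj₂ (¬p , d) | _             = inj₂ (¬p ∘ proj₁ , contrapose (⇒I (∧E₁ hyp₀)) d)
  ... | inj₁ _        | inj₂ (¬q , e) = inj₂ (¬q ∘ proj₂ , contrapose (⇒I (∧E₂ hyp₀)) e)
  Δ₀-decision (or φ ψ) ρ with Δ₀-decision φ ρ | Δ₀-decision ψ ρ
  ... | inj₁ (p , d)  | _             = inj₁ (inj₁ p , ∨I₁ d)
  ... | inj₂ _        | inj₁ (q , e)  = inj₁ (inj₂ q , ∨I₂ e)
  ... | inj₂ (¬p , d) | inj₂ (¬q , e) = inj₂ ([ ¬p , ¬q ]′ ,
          contrapose (⇒I (∨E hyp₀ (¬E hyp₀ (weaken-[] d)) hyp₀)) e)
  Δ₀-decision (imp φ ψ) ρ with Δ₀-decision φ ρ | Δ₀-decision ψ ρ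
  ... | inj₂ (¬p , d) | _             = inj₁ ((λ p → contradiction p ¬p) , ⇒I (¬E hyp₀ (weaken₁ d)))
  ... | inj₁ _        | inj₁ (q , e)  = inj₁ (const q , ⇒I (weaken₁ e))
  ... | inj₁ (p , d)  | inj₂ (¬q , e) = inj₂ ((λ f → ¬q (f p)) ,
          contrapose (⇒I (⇒E hyp₀ (weaken₁ d))) e)
  Δ₀-decision (ball t {φ} δ) ρ
    with bounded-search (λ k → Δ₀-decision δ (k Vector.∷ ρ)) (⟦ t ⟧ᵗ ρ)
  ... | inj₁ ds = inj₁ ((λ k k≤t → proj₁ (ds k (≤-trans k≤t (≤-reflexive (⟦renᵗ⟧ suc t))))) ,
          ≡⇒⊢ (sym (sub-all≤ ρ t φ))
            (∀≤-intro ρ t λ k k≤t → ≡⇒⊢ (sym (num-∷ k ρ φ)) (proj₂ (ds k k≤t))))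
  ... | inj₂ (k , k≤t , ¬p , d) =
          inj₂ ((λ p → ¬p (p k (≤-trans k≤t (≤-reflexive (sym (⟦renᵗ⟧ suc t)))))) ,
            ≡⇒⊢ (cong ~_ (sym (sub-all≤ ρ t φ))) (contrapose
              (⇒I (⇒E (∀E (numeral k) hyp₀) (≦-intro ρ t k≤t)))
              (≡⇒⊢ (cong ~_ (sym (num-∷ k ρ φ))) d)))
  Δ₀-decision (bex t {φ} δ) ρ
    -- With the outcomes swapped, the search looks for a true instance and otherwise collects
    -- refutations of all instances.
    with bounded-search (λ k → Sum.swap (Δ₀-decision δ (k Vector.∷ ρ))) (⟦ t ⟧ᵗ ρ)
  ... | inj₁ ds =
          inj₂ ((λ { (k , k≤t , p) → proj₁ (ds k (≤-trans k≤t (≤-reflexive (⟦renᵗ⟧ suc t)))) p }) ,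
            ≡⇒⊢ (cong ~_ (sym (sub-ex≤ ρ t φ)))
              (∀¬⇒¬∃ (∀≤-intro ρ t λ k k≤t → ≡⇒⊢ (cong ~_ (sym (num-∷ k ρ φ))) (proj₂ (ds k k≤t)))))
  ... | inj₂ (k , k≤t , p , d) =
          inj₁ ((k , ≤-trans k≤t (≤-reflexive (sym (⟦renᵗ⟧ suc t))) , p) ,
            ≡⇒⊢ (sym (sub-ex≤ ρ t φ))
              (∃I (numeral k) (∧I (≦-intro ρ t k≤t) (≡⇒⊢ (sym (num-∷ k ρ φ)) d))))

  -- A true matrix cannot fall under the refuted alternative of `Δ₀-decision`, which also carries
  -- its falsity in ℕ. The unbounded quantifiers are witnessed by numerals.
  Σ₁-complete : Σ₁ φ → (ρ : Vector ℕ m) → ⟦ φ ⟧ ρ → T ⊢ sub (num {n = 0} ρ) φ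
  Σ₁-complete (Δ₀⇒Σ₁ δ) ρ p with Δ₀-decision δ ρ
  ... | inj₁ (_ , d)  = d
  ... | inj₂ (¬p , _) = contradiction p ¬p
  Σ₁-complete (exs {φ} σ) ρ (k , p) =
    ∃I (numeral k) (≡⇒⊢ (sym (num-∷ k ρ φ)) (Σ₁-complete σ (k Vector.∷ ρ) p))

-- Arithmetical complexity of `Fml`

Elem-Δ₀ : (m c y : Term n) → Δ₀ (Elem m c y)
Elem-Δ₀ m c y = bex c (eq _ _)

Unary-Δ₀ : (k : ℕ) (m c y : Term n) → Δ₀ (Unary k m c y)
Unary-Δ₀ k m c y = bex y (and (Elem-Δ₀ _ _ _) (eq _ _))

Binary-Δ₀ : (k : ℕ) (m c y : Term n) → Δ₀ (Binary k m c y)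
Binary-Δ₀ k m c y =
  bex y (bex (wkᵗ y) (and (Elem-Δ₀ _ _ _) (and (Elem-Δ₀ _ _ _) (eq _ _))))

TermStep-Δ₀ : (m c y : Term n) → Δ₀ (TermStep m c y)
TermStep-Δ₀ m c y =
  or (bex y (eq _ _)) (or (eq _ _) (or (Unary-Δ₀ tag-𝗌 m c y)
    (or (Binary-Δ₀ tag-⊕ m c y) (Binary-Δ₀ tag-⊗ m c y))))

FmlStep-Δ₀ : (m c d y : Term n) → Δ₀ (FmlStep m c d y)
FmlStep-Δ₀ m c d y =
  or (Binary-Δ₀ tag-≐ m c y) (or (Binary-Δ₀ tag-≦ m c y)
    (or (Unary-Δ₀ tag-~ m d y) (or (Binary-Δ₀ tag-∧ m d y) (or (Binary-Δ₀ tag-∨ m d y)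
      (or (Binary-Δ₀ tag-⇒ m d y) (or (Unary-Δ₀ tag-all m d y) (Unary-Δ₀ tag-ex m d y)))))))

Fml-Σ₁ : Σ₁ Fml
Fml-Σ₁ = exs (exs (exs (Δ₀⇒Σ₁ (and (Elem-Δ₀ x₂ x₀ x₃) (and
  (ball x₃ (imp (Elem-Δ₀ x₃ x₂ x₀) (TermStep-Δ₀ x₃ x₂ x₀)))
  (ball x₃ (imp (Elem-Δ₀ x₃ x₁ x₀) (FmlStep-Δ₀ x₃ x₂ x₁ x₀))))))))

-- Coding of finite sets

-- Written so that the truth of `Elem` at variables computes to it.
Elemᴺ : (m c y : ℕ) → Set
Elemᴺ m c y = ∃ λ q → q ≤ c × c ≡ q ℕ.* suc (suc y ℕ.* m)

modulus : ℕ → ℕ → ℕ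
modulus m y = suc (suc y ℕ.* m)

code : ℕ → List ℕ → ℕ
code m ys = product (map (modulus m) ys)

≤⇒∣! : ∀ {d K} .{{_ : NonZero d}} → d ≤ K → d ∣ℕ K !
≤⇒∣! {d = suc d} d≤K = ∣-trans (m∣m*n (d !)) (m≤n⇒m!∣n! d≤K)

-- A common divisor divides both `1 + (1 + y)·m` and `(1 + y)·m`, hence `1`.
modulus-coprime-base : ∀ {d} m y → d ∣ℕ modulus m y → Coprime d m
modulus-coprime-base m y d∣ {i} (i∣d , i∣m) = ∣1⇒≡1 (∣m+n∣m⇒∣n
  (subst (i ∣ℕ_) (ℕ.+-comm 1 (suc y ℕ.* m)) (∣-trans i∣d d∣))
  (∣n⇒∣m*n (suc y) i∣m))

-- With `z = 1 + y + o`, the moduli differ by `(1 + o)·K!`. Being coprime to `K!`, `d` divides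
-- `1 + o`; but `1 + o ≤ K` divides `K!`, so `d` divides `K!` as well and must be `1`.
modulus-common-divisor : ∀ {K y z d} → y ℕ.< z → z ≤ K →
                         d ∣ℕ modulus (K !) y → d ∣ℕ modulus (K !) z → d ≡ 1
modulus-common-divisor {K} {y} {z} {d} y<z z≤K d∣y d∣z with ℕ.m≤n⇒∃[o]m+o≡n y<z
... | o , refl = d⊥m (∣-refl , ∣-trans d∣1+o (≤⇒∣! (≤-trans (s≤s (ℕ.m≤n+m o y)) z≤K)))
  where
  difference : modulus (K !) (suc y ℕ.+ o) ≡ modulus (K !) y ℕ.+ suc o ℕ.* K !
  difference = cong suc (trans (cong (ℕ._* K !) (sym (ℕ.+-suc (suc y) o)))
                               (ℕ.*-distribʳ-+ (K !) (suc y) (suc o)))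
  d⊥m : Coprime d (K !)
  d⊥m = modulus-coprime-base (K !) y d∣y
  d∣1+o : d ∣ℕ suc o
  d∣1+o = coprime-divisor d⊥m (subst (d ∣ℕ_) (ℕ.*-comm (suc o) (K !))
    (∣m+n∣m⇒∣n (subst (d ∣ℕ_) difference d∣z) d∣y))

modulus-coprime : ∀ {K y z} → y ≤ K → z ≤ K → y ≢ z → Coprime (modulus (K !) y) (modulus (K !) z)
modulus-coprime {y = y} {z} y≤K z≤K y≢z (d∣y , d∣z) with ℕ.<-cmp y z
... | tri< y<z _ _ = modulus-common-divisor y<z z≤K d∣y d∣z
... | tri≈ _ y≡z _ = contradiction y≡z y≢z
... | tri> _ _ z<y = modulus-common-divisor z<y y≤K d∣z d∣y

-- The modulus of `y` is coprime to every factor that belongs to another number, so such factors can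
-- be stripped off one by one. It cannot survive to the empty product `1`, since `(1 + y)·K!` is
-- nonzero.
∣code⇒∈ : ∀ {K y ys} → y ≤ K → All (_≤ K) ys → modulus (K !) y ∣ℕ code (K !) ys → y ∈ ys
∣code⇒∈ {K} {y} y≤K [] d = contradiction
  (ℕ.m*n≡0⇒m≡0 (suc y) (K !) {{K ℕ.!≢0}} (ℕ.suc-injective (∣1⇒≡1 d))) λ ()
∣code⇒∈ {K} {y} {z ∷ zs} y≤K (z≤K ∷ zs≤K) d with y ℕ.≟ z
... | yes y≡z = here y≡z
... | no  y≢z = there (∣code⇒∈ y≤K zs≤K (coprime-divisor (modulus-coprime y≤K z≤K y≢z) d))

Elem⇒∈ : ∀ {K y ys} → y ≤ K → All (_≤ K) ys → Elemᴺ (K !) (code (K !) ys) y → y ∈ ys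
Elem⇒∈ y≤K ys≤K (q , _ , c≡) = ∣code⇒∈ y≤K ys≤K (divides q c≡)

-- The modulus of a member is one of the factors, for any `m`; the quotient is at most the product
-- because moduli are positive.
∈⇒Elem : ∀ {m y ys} → y ∈ ys → Elemᴺ m (code m ys) y
∈⇒Elem {m} {y} y∈ys with ∈⇒∣product (∈-map⁺ (modulus m) y∈ys)
... | divides q c≡ = q , ≤-trans (ℕ.m≤m*n q (modulus m y)) (≤-reflexive (sym c≡)) , c≡

-- Truth of Fml

-- With `P` abstract, closure can be proved for membership in lists and carried over to codes by
-- monotonicity.
Unaryᴺ Binaryᴺ : ℕ → Pred ℕ 0ℓ → Pred ℕ 0ℓ
Unaryᴺ k P y = ∃ λ z → z ≤ y × P z × y ≡ pair k z
Binaryᴺ k P y = ∃ λ z → z ≤ y × ∃ λ w → w ≤ y × P z × P w × y ≡ pair k (pair z w)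

-- Stated so as to unfold to ⟦ TermStep x₃ x₂ x₀ ⟧ and ⟦ FmlStep x₃ x₂ x₁ x₀ ⟧
-- when P and Q are membership in coded sets.
TermStepᴺ : Pred ℕ 0ℓ → Pred ℕ 0ℓ
TermStepᴺ P y =
    (∃ λ i → i ≤ y × y ≡ pair tag-var i)
  ⊎ y ≡ pair tag-𝟘 0
  ⊎ Unaryᴺ tag-𝗌 P y
  ⊎ Binaryᴺ tag-⊕ P y
  ⊎ Binaryᴺ tag-⊗ P y

FmlStepᴺ : (P Q : Pred ℕ 0ℓ) → Pred ℕ 0ℓ
FmlStepᴺ P Q y =
    Binaryᴺ tag-≐ P y
  ⊎ Binaryᴺ tag-≦ P y
  ⊎ Unaryᴺ tag-~ Q y
  ⊎ Binaryᴺ tag-∧ Q y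
  ⊎ Binaryᴺ tag-∨ Q y
  ⊎ Binaryᴺ tag-⇒ Q y
  ⊎ Unaryᴺ tag-all Q y
  ⊎ Unaryᴺ tag-ex Q y

module _ {P P′ : Pred ℕ 0ℓ} (f : P Unary.⊆ P′) where

  Unaryᴺ-map : ∀ k → Unaryᴺ k P Unary.⊆ Unaryᴺ k P′
  Unaryᴺ-map k (z , z≤y , p , e) = z , z≤y , f p , e

  Binaryᴺ-map : ∀ k → Binaryᴺ k P Unary.⊆ Binaryᴺ k P′
  Binaryᴺ-map k (z , z≤y , w , w≤y , p , q , e) = z , z≤y , w , w≤y , f p , f q , e

  TermStepᴺ-map : TermStepᴺ P Unary.⊆ TermStepᴺ P′
  TermStepᴺ-map = Sum.map₂ (Sum.map₂ (Sum.map (Unaryᴺ-map tag-𝗌)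
    (Sum.map (Binaryᴺ-map tag-⊕) (Binaryᴺ-map tag-⊗))))

FmlStepᴺ-map : ∀ {P P′ Q Q′ : Pred ℕ 0ℓ} → P Unary.⊆ P′ → Q Unary.⊆ Q′ →
               FmlStepᴺ P Q Unary.⊆ FmlStepᴺ P′ Q′
FmlStepᴺ-map f g =
  Sum.map (Binaryᴺ-map f tag-≐) (Sum.map (Binaryᴺ-map f tag-≦)
    (Sum.map (Unaryᴺ-map g tag-~) (Sum.map (Binaryᴺ-map g tag-∧) (Sum.map (Binaryᴺ-map g tag-∨)
      (Sum.map (Binaryᴺ-map g tag-⇒) (Sum.map (Unaryᴺ-map g tag-all) (Unaryᴺ-map g tag-ex)))))))

-- The two component bounds supply the bounds on `z` and `w` in `Unaryᴺ` and `Binaryᴺ`.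
pair-≥ˡ : ∀ a b → a ≤ pair a b
pair-≥ˡ a b = ℕ.m≤n+m a _

pair-≥ʳ : ∀ a b → b ≤ pair a b
pair-≥ʳ a b = ≤-trans (ℕ.m≤n+m b a) (≤-trans (square (a ℕ.+ b)) (ℕ.m≤m+n _ a))
  where
  square : ∀ c → c ≤ c ℕ.* c
  square zero    = z≤n
  square (suc c) = ℕ.m≤m*n (suc c) (suc c)

Unaryᴺ-intro : ∀ {P : Pred ℕ 0ℓ} k {z} → P z → Unaryᴺ k P (pair k z)
Unaryᴺ-intro k {z} p = z , pair-≥ʳ k z , p , refl

Binaryᴺ-intro : ∀ {P : Pred ℕ 0ℓ} k {z w} → P z → P w → Binaryᴺ k P (pair k (pair z w))
Binaryᴺ-intro k {z} {w} p q =
  z , ≤-trans (pair-≥ˡ z w) (pair-≥ʳ k _) , w , ≤-trans (pair-≥ʳ z w) (pair-≥ʳ k _) , p , q , refl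

-- Lists of codes closed under the formation rules

subterms : Term n → List ℕ
subterms t@(var _) = gnᵗ t ∷ []
subterms t@𝟘       = gnᵗ t ∷ []
subterms t@(𝗌 u)   = gnᵗ t ∷ subterms u
subterms t@(u ⊕ v) = gnᵗ t ∷ subterms u ++ subterms v
subterms t@(u ⊗ v) = gnᵗ t ∷ subterms u ++ subterms v

gnᵗ∈subterms : (t : Term n) → gnᵗ t ∈ subterms t
gnᵗ∈subterms (var i) = here refl
gnᵗ∈subterms 𝟘       = here refl
gnᵗ∈subterms (𝗌 t)   = here refl
gnᵗ∈subterms (t ⊕ u) = here refl
gnᵗ∈subterms (t ⊗ u) = here refl

All-++ : ∀ {A B C : Pred ℕ 0ℓ} {xs ys} → A Unary.⊆ C → B Unary.⊆ C →
         All A xs → All B ys → All C (xs ++ ys)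
All-++ f g as bs = All.++⁺ (All.map f as) (All.map g bs)

-- The head is formed from the heads of the operands' lists; the tails are closed by induction and
-- stay so in the longer list.
subterms-closed : (t : Term n) → All (TermStepᴺ (_∈ subterms t)) (subterms t)
subterms-closed (var i) = inj₁ (toℕ i , pair-≥ʳ tag-var (toℕ i) , refl) ∷ []
subterms-closed 𝟘       = inj₂ (inj₁ refl) ∷ []
subterms-closed (𝗌 t)   =
  inj₂ (inj₂ (inj₁ (Unaryᴺ-intro tag-𝗌 (there (gnᵗ∈subterms t))))) ∷
  All.map (TermStepᴺ-map there) (subterms-closed t)
subterms-closed (t ⊕ u) =
  inj₂ (inj₂ (inj₂ (inj₁ (Binaryᴺ-intro tag-⊕
    (there (∈-++⁺ˡ (gnᵗ∈subterms t))) (there (∈-++⁺ʳ (subterms t) (gnᵗ∈subterms u))))))) ∷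
  All-++ (TermStepᴺ-map (there ∘ ∈-++⁺ˡ)) (TermStepᴺ-map (there ∘ ∈-++⁺ʳ (subterms t)))
    (subterms-closed t) (subterms-closed u)
subterms-closed (t ⊗ u) =
  inj₂ (inj₂ (inj₂ (inj₂ (Binaryᴺ-intro tag-⊗
    (there (∈-++⁺ˡ (gnᵗ∈subterms t))) (there (∈-++⁺ʳ (subterms t) (gnᵗ∈subterms u))))))) ∷
  All-++ (TermStepᴺ-map (there ∘ ∈-++⁺ˡ)) (TermStepᴺ-map (there ∘ ∈-++⁺ʳ (subterms t)))
    (subterms-closed t) (subterms-closed u)

-- All atomic subformulas share one list, as `Fml` provides a single set of terms.
termCodes : Formula n → List ℕ
termCodes (t ≐ u) = subterms t ++ subterms u
termCodes (t ≦ u) = subterms t ++ subterms u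
termCodes (~ φ)   = termCodes φ
termCodes (φ ∧ ψ) = termCodes φ ++ termCodes ψ
termCodes (φ ∨ ψ) = termCodes φ ++ termCodes ψ
termCodes (φ ⇒ ψ) = termCodes φ ++ termCodes ψ
termCodes (all φ) = termCodes φ
termCodes (ex φ)  = termCodes φ

++-closed : (xs : List ℕ) {ys : List ℕ} → All (TermStepᴺ (_∈ xs)) xs → All (TermStepᴺ (_∈ ys)) ys →
            All (TermStepᴺ (_∈ xs ++ ys)) (xs ++ ys)
++-closed xs = All-++ (TermStepᴺ-map ∈-++⁺ˡ) (TermStepᴺ-map (∈-++⁺ʳ xs))

termCodes-closed : (φ : Formula n) → All (TermStepᴺ (_∈ termCodes φ)) (termCodes φ)
termCodes-closed (t ≐ u) = ++-closed (subterms t) (subterms-closed t) (subterms-closed u)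
termCodes-closed (t ≦ u) = ++-closed (subterms t) (subterms-closed t) (subterms-closed u)
termCodes-closed (~ φ)   = termCodes-closed φ
termCodes-closed (φ ∧ ψ) = ++-closed (termCodes φ) (termCodes-closed φ) (termCodes-closed ψ)
termCodes-closed (φ ∨ ψ) = ++-closed (termCodes φ) (termCodes-closed φ) (termCodes-closed ψ)
termCodes-closed (φ ⇒ ψ) = ++-closed (termCodes φ) (termCodes-closed φ) (termCodes-closed ψ)
termCodes-closed (all φ) = termCodes-closed φ
termCodes-closed (ex φ)  = termCodes-closed φ

subformulas : Formula n → List ℕ
subformulas χ@(_ ≐ _) = gn χ ∷ []
subformulas χ@(_ ≦ _) = gn χ ∷ []
subformulas χ@(~ φ)   = gn χ ∷ subformulas φ
subformulas χ@(φ ∧ ψ) = gn χ ∷ subformulas φ ++ subformulas ψ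
subformulas χ@(φ ∨ ψ) = gn χ ∷ subformulas φ ++ subformulas ψ
subformulas χ@(φ ⇒ ψ) = gn χ ∷ subformulas φ ++ subformulas ψ
subformulas χ@(all φ) = gn χ ∷ subformulas φ
subformulas χ@(ex φ)  = gn χ ∷ subformulas φ

gn∈subformulas : (φ : Formula n) → gn φ ∈ subformulas φ
gn∈subformulas (t ≐ u) = here refl
gn∈subformulas (t ≦ u) = here refl
gn∈subformulas (~ φ)   = here refl
gn∈subformulas (φ ∧ ψ) = here refl
gn∈subformulas (φ ∨ ψ) = here refl
gn∈subformulas (φ ⇒ ψ) = here refl
gn∈subformulas (all φ) = here refl
gn∈subformulas (ex φ)  = here refl

FmlClosed : Formula n → Set
FmlClosed φ = All (FmlStepᴺ (_∈ termCodes φ) (_∈ subformulas φ)) (subformulas φ)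

atom-operands : ∀ k (t u : Term n) →
                Binaryᴺ k (_∈ subterms t ++ subterms u) (pair k (pair (gnᵗ t) (gnᵗ u)))
atom-operands k t u =
  Binaryᴺ-intro k (∈-++⁺ˡ (gnᵗ∈subterms t)) (∈-++⁺ʳ (subterms t) (gnᵗ∈subterms u))

module _ (φ : Formula n) {z : ℕ} where

  -- Here `z` stands for the code of the compound formula at the head, so that `~`, `all` and `ex`
  -- share the argument.
  unary-operand : ∀ k → Unaryᴺ k (_∈ z ∷ subformulas φ) (pair k (gn φ))
  unary-operand k = Unaryᴺ-intro k (there (gn∈subformulas φ))

  unary-rest : FmlClosed φ →
               All (FmlStepᴺ (_∈ termCodes φ) (_∈ z ∷ subformulas φ)) (subformulas φ)
  unary-rest = All.map (FmlStepᴺ-map id there)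

module _ (φ : Formula m) (ψ : Formula n) {z : ℕ} where

  binary-operands : ∀ k → Binaryᴺ k (_∈ z ∷ subformulas φ ++ subformulas ψ) (pair k (pair (gn φ) (gn ψ)))
  binary-operands k = Binaryᴺ-intro k
    (there (∈-++⁺ˡ (gn∈subformulas φ))) (there (∈-++⁺ʳ (subformulas φ) (gn∈subformulas ψ)))

  binary-rest : FmlClosed φ → FmlClosed ψ →
                All (FmlStepᴺ (_∈ termCodes φ ++ termCodes ψ) (_∈ z ∷ subformulas φ ++ subformulas ψ))
                    (subformulas φ ++ subformulas ψ)
  binary-rest = All-++ (FmlStepᴺ-map ∈-++⁺ˡ (there ∘ ∈-++⁺ˡ))
    (FmlStepᴺ-map (∈-++⁺ʳ (termCodes φ)) (there ∘ ∈-++⁺ʳ (subformulas φ)))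

subformulas-closed : (φ : Formula n) → FmlClosed φ
subformulas-closed (t ≐ u) = inj₁ (atom-operands tag-≐ t u) ∷ []
subformulas-closed (t ≦ u) = inj₂ (inj₁ (atom-operands tag-≦ t u)) ∷ []
subformulas-closed (~ φ)   =
  inj₂ (inj₂ (inj₁ (unary-operand φ tag-~))) ∷ unary-rest φ (subformulas-closed φ)
subformulas-closed (φ ∧ ψ) =
  inj₂ (inj₂ (inj₂ (inj₁ (binary-operands φ ψ tag-∧)))) ∷
  binary-rest φ ψ (subformulas-closed φ) (subformulas-closed ψ)
subformulas-closed (φ ∨ ψ) =
  inj₂ (inj₂ (inj₂ (inj₂ (inj₁ (binary-operands φ ψ tag-∨))))) ∷
  binary-rest φ ψ (subformulas-closed φ) (subformulas-closed ψ)
subformulas-closed (φ ⇒ ψ) =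
  inj₂ (inj₂ (inj₂ (inj₂ (inj₂ (inj₁ (binary-operands φ ψ tag-⇒)))))) ∷
  binary-rest φ ψ (subformulas-closed φ) (subformulas-closed ψ)
subformulas-closed (all φ) =
  inj₂ (inj₂ (inj₂ (inj₂ (inj₂ (inj₂ (inj₁ (unary-operand φ tag-all))))))) ∷
  unary-rest φ (subformulas-closed φ)
subformulas-closed (ex φ)  =
  inj₂ (inj₂ (inj₂ (inj₂ (inj₂ (inj₂ (inj₂ (unary-operand φ tag-ex))))))) ∷
  unary-rest φ (subformulas-closed φ)

Fml-true : (φ : Formula n) → ⟦ Fml ⟧ (const (gn φ))
Fml-true φ = K ! , code (K !) terms , code (K !) formulas
  , ∈⇒Elem (gn∈subformulas φ)
  -- For `y ≤ gn φ ≤ K` the codes have no members beyond the lists, so closure is read off the list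
  -- and returned to the code along `∈⇒Elem`.
  , (λ y y≤x e → TermStepᴺ-map ∈⇒Elem
      (All.lookup (termCodes-closed φ) (Elem⇒∈ (≤-trans y≤x x≤K) terms≤K e)))
  , (λ y y≤x e → FmlStepᴺ-map ∈⇒Elem ∈⇒Elem
      (All.lookup (subformulas-closed φ) (Elem⇒∈ (≤-trans y≤x x≤K) formulas≤K e)))
  where
  terms formulas : List ℕ
  terms    = termCodes φ
  formulas = subformulas φ
  K : ℕ
  -- A joint bound, as `Fml` uses one `m` for both sets; `0` is the default value of `max`.
  K = max 0 (terms ++ formulas)
  terms≤K : All (_≤ K) terms
  terms≤K = All.++⁻ˡ terms (xs≤max 0 (terms ++ formulas))
  formulas≤K : All (_≤ K) formulas
  formulas≤K = All.++⁻ʳ terms (xs≤max 0 (terms ++ formulas))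
  x≤K : gn φ ≤ K
  x≤K = All.lookup formulas≤K (gn∈subformulas φ)

-- Consistency statements and the Rosser condition

Conᴴ⇒Conˢ : (Pr : Formula 1) → PA ∪ ｛ Conᴴ Pr ｝ ⊢* Conˢ Pr
-- The term `¬̇ ⌜ φ ⌝` is only provably equal to the numeral `⌜ ~ φ ⌝`, so the second hypothesis is
-- first moved along `negation`.
Conᴴ⇒Conˢ Pr (_ , φ , refl) = ⇒I (¬I {ψ = Pr ⟨ ¬̇ ⌜ φ ⌝ ⟩}
  (≡⇒⊢ (sym (⟨⟩≡[] Pr (¬̇ ⌜ φ ⌝)))
    (≐E Pr (≐-sym negation) (≡⇒⊢ (⟨⟩≡[] Pr ⌜ ~ φ ⌝) hyp₀)))
  (⇒E instance-of-Conᴴ (∧I (weaken-[] (Σ₁-complete Fml-Σ₁ (const (gn φ)) (Fml-true φ))) hyp₁)))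
  where
  open Arithmetic {T = PA ∪ ｛ Conᴴ Pr ｝} inj₁
  negation : PA ∪ ｛ Conᴴ Pr ｝ ∣ Γ ⊢ ¬̇ ⌜ φ ⌝ ≐ ⌜ ~ φ ⌝
  -- The value of `¬̇ x₀` at `gn φ` is `gn (~ φ)` by computation, as `pairᵗ` mirrors `pair`.
  negation = term-value (const {B = Fin 1} (gn φ)) (¬̇ x₀)
  instance-of-Conᴴ : PA ∪ ｛ Conᴴ Pr ｝ ∣ Γ ⊢ Fml ⟨ ⌜ φ ⌝ ⟩ ∧ Pr ⟨ ⌜ φ ⌝ ⟩ ⇒ ~ Pr ⟨ ¬̇ ⌜ φ ⌝ ⟩
  instance-of-Conᴴ = ≡⇒⊢
    (cong₂ _⇒_ (cong₂ _∧_ (sym (⟨⟩≡[] Fml ⌜ φ ⌝)) (sym (⟨⟩≡[] Pr ⌜ φ ⌝)))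
               (cong ~_ (sub-sub (inst ⌜ φ ⌝) (const (¬̇ x₀)) Pr)))
    (∀E ⌜ φ ⌝ (≡⇒⊢ (inContext-sentence (Conᴴ Pr)) (ax (inj₂ refl))))

-- Stated in every context, since `CondE` compares formulas over the same context.
PA⊢0≢1 : PA ⊢ ~ (𝟘 {n} ≐ 𝗌 𝟘)
PA⊢0≢1 = Arithmetic.numeral-≢ id {a = 0} {1} λ ()

proposition2p6 : (S T : Theory) →
    CETheory S → CETheory T →
    Consistent S → Consistent T →
    S Extends PA → T Extends PA → T Extends S →
    (Pr : Formula 1) → Σ₁ Pr → ProvabilityPredicate S T Pr →
    (PA ∪ ｛ Conᴴ Pr ｝ ⊢* Conˢ Pr)
    × ((T ⊢* Conˢ Pr) → Ros T Pr)
    × (Ros T Pr → CondC S Pr → T ⊢* Conˢ Pr)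
    × (Ros T Pr → T ⊢ Conᴸ Pr)
    × (T ⊢ Conᴸ Pr → CondE S T Pr → Ros T Pr)
proposition2p6 S T _ _ _ _ _ T⊇PA T⊇S Pr _ Pr-provability =
  Conᴴ⇒Conˢ Pr , Conˢ⇒Ros , Ros⇒Conˢ , Ros⇒Conᴸ , Conᴸ⇒Ros
  where
  -- Provability of `~ φ` is verified in `S`, hence in `T`, and excludes that of `φ`.
  Conˢ⇒Ros : (T ⊢* Conˢ Pr) → Ros T Pr
  Conˢ⇒Ros con φ ⊢¬φ = ¬I
    (weaken-[] (T⊇S _ (Equivalence.to (Pr-provability (~ φ)) ⊢¬φ)))
    (⇒E (weaken-[] (con (_ , φ , refl))) hyp₀)

  -- By `CondC` the two provability claims yield that of `φ ∧ ~ φ`, which is refutable by logic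
  -- alone and so falls under `Ros`.
  Ros⇒Conˢ : Ros T Pr → CondC S Pr → T ⊢* Conˢ Pr
  Ros⇒Conˢ ros C (_ , φ , refl) = ⇒I (¬I
    (⇒E (weaken-[] (T⊇S _ (C φ (~ φ)))) (∧I hyp₁ hyp₀))
    (weaken-[] (ros (φ ∧ ~ φ) (¬I (∧E₁ hyp₀) (∧E₂ hyp₀)))))

  Ros⇒Conᴸ : Ros T Pr → T ⊢ Conᴸ Pr
  Ros⇒Conᴸ ros = ros {0} (𝟘 ≐ 𝗌 𝟘) (T⊇PA _ PA⊢0≢1)

  -- A refutable `φ` is equivalent in `T` to `0 = 1`, so `CondE` reduces its provability to that of
  -- `0 = 1`.
  Conᴸ⇒Ros : T ⊢ Conᴸ Pr → CondE S T Pr → Ros T Pr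
  -- Gödel numbers ignore the context, so `0 = 1` in the context of `φ` has the numeral that occurs
  -- in `Conᴸ`.
  Conᴸ⇒Ros con E φ ⊢¬φ = contrapose (∧E₁ (T⊇S _ (E φ (𝟘 ≐ 𝗌 𝟘) φ⟺0≐1))) con
    where
    φ⟺0≐1 : T ⊢ φ ⟺ 𝟘 ≐ 𝗌 𝟘
    φ⟺0≐1 = ∧I (⇒I (¬E hyp₀ (weaken₁ ⊢¬φ))) (⇒I (¬E hyp₀ (weaken₁ (T⊇PA _ PA⊢0≢1))))
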